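{- Let $\mathcal{P}$ be the set of integer partitions that satisfy Condition($2$) and in which $1+2+2$ does not occur as a sub-partition. Then, as formal power series in $x,q$, writing $N=i+2j+3k$, $$\sum_{\pi\in\mathcal{P}}x^{\ell(\pi)}q^{|\pi|}=\sum_{i,j,k\ge 0}\frac{x^{N}q^{\frac{N(N-1)}{2}+i+j^2+2j+2k}+x^{N+2}q^{\frac{(N+2)(N+1)}{2}+i+j^2+2j+2k+1}-x^{N+3}q^{\frac{(N+3)(N+2)}{2}+i+j^2+2j+2k+2}}{(q;q)_i\,(q^2;q^2)_j\,(q^3;q^3)_k}.$$
   Context: Partitions are finite weakly increasing sequences of positive integers (the empty partition is included); $\ell(\pi)$ is the number of parts and $|\pi|$ the sum of the parts of $\pi$. A sub-partition of a partition is a contiguous portion of it. For a fixed integer $c$, a partition $\pi=\lambda_1+\lambda_2+\cdots+\lambda_m$ with $\lambda_1\le\lambda_2\le\cdots\le\lambda_m$ satisfies Condition($c$) if $\lambda_{s+3}-\lambda_s\ge 3$ for all $1\le s\le m-3$, and, for all $1\le s\le m-2$, if $\lambda_{s+2}-\lambda_s\le 1$ then $\lambda_s+\lambda_{s+1}+\lambda_{s+2}\equiv c\pmod 3$. For $n\ge 0$, $(a;q)_n=\prod_{0\le t<n}(1-aq^t)$. All identities are identities of formal power series. -}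

module Defs where

open import Data.Bool.Base using (if_then_else_; _∧_)
open import Data.Fin.Base using (toℕ)
import Data.Integer.Base as ℤ
open ℤ using (ℤ; +_; 0ℤ; 1ℤ)
open import Data.Integer.Divisibility using () renaming (_∣_ to _∣ℤ_)
open import Data.List.Base using (List; []; _∷_; foldr; map; applyUpTo; lookup)
open import Data.List.Membership.Propositional using (_∉_)
open import Data.List.Relation.Binary.Infix.Heterogeneous using (Infix)
open import Data.List.Relation.Unary.All using (All)
open import Data.List.Relation.Unary.Linked using (Linked)
open import Data.List.Relation.Unary.Unique.Propositional using (Unique)
open import Data.Nat.Base using (ℕ; zero; suc; _+_; _∸_; _≤_; _≥_; _<_; _≡ᵇ_)
open import Data.Product.Base using (_×_; ∃-syntax)
open import Relation.Binary.PropositionalEquality using (_≡_)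
open import Relation.Nullary.Negation using (¬_)

IsPartition : List ℕ → Set
IsPartition π = All (0 <_) π × Linked _≤_ π

-- Truncated subtraction agrees with subtraction here: Condition is only
-- imposed on partitions, whose parts are weakly increasing.
Condition : ℤ → List ℕ → Set
Condition c π =
    (∀ s s+3 → toℕ s+3 ≡ toℕ s + 3 → part s+3 ∸ part s ≥ 3)
  × (∀ s s+1 s+2 → toℕ s+1 ≡ toℕ s + 1 → toℕ s+2 ≡ toℕ s + 2 →
       part s+2 ∸ part s ≤ 1 →
       + 3 ∣ℤ + (part s + part s+1 + part s+2) ℤ.- c)
  where part = lookup π

_isSubPartitionOf_ : List ℕ → List ℕ → Set
σ isSubPartitionOf π = Infix _≡_ σ π

𝒫 : List ℕ → Set
𝒫 π = IsPartition π × Condition (+ 2) π × ¬ ((1 ∷ 2 ∷ 2 ∷ []) isSubPartitionOf π)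

-- ℤ[[x,q]]: the series f has coefficient f a n at xᵃqⁿ.
Series : Set
Series = ℕ → ℕ → ℤ

infix  10 x^_q^_
infixl 6 _⊕_ _⊖_
infixl 7 _⊛_ _⊘_
infixr 8 _↑_

sumℤ : List ℤ → ℤ
sumℤ = foldr ℤ._+_ 0ℤ

x^_q^_ : ℕ → ℕ → Series
(x^ a q^ n) a′ n′ = if (a′ ≡ᵇ a) ∧ (n′ ≡ᵇ n) then 1ℤ else 0ℤ

𝟙 : Series
𝟙 = x^ 0 q^ 0

_⊕_ _⊖_ _⊛_ : Series → Series → Series
(f ⊕ g) a n = f a n ℤ.+ g a n
(f ⊖ g) a n = f a n ℤ.- g a n
(f ⊛ g) a n =
  sumℤ (applyUpTo (λ b → sumℤ (applyUpTo (λ m → f b m ℤ.* g (a ∸ b) (n ∸ m)) (suc n))) (suc a))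

_↑_ : Series → ℕ → Series
f ↑ zero  = 𝟙
f ↑ suc k = f ⊛ f ↑ k

-- The reciprocal of a series with constant term 1, as the geometric series
-- 1/f = Σ_k (1 - f)ᵏ.  Since 1 - f has zero constant term, (1 - f)ᵏ has no
-- terms of total degree below k, so truncating at k ≤ a + n is exact at xᵃqⁿ.
-- (For any other constant term the value is meaningless.)
recip : Series → Series
recip f a n = sumℤ (applyUpTo (λ k → ((𝟙 ⊖ f) ↑ k) a n) (suc (a + n)))

_⊘_ : Series → Series → Series
f ⊘ g = f ⊛ recip g

-- (a;p)ₙ = ∏_{0≤t<n} (1 - a pᵗ)
poch : Series → Series → ℕ → Series
poch a p zero    = 𝟙
poch a p (suc n) = poch a p n ⊛ (𝟙 ⊖ a ⊛ p ↑ n)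

-- (qᵈ;qᵈ)ₙ
qpoch : ℕ → ℕ → Series
qpoch d n = poch (x^ 0 q^ d) (x^ 0 q^ d) n

-- HasSum P f F: the family f i, over those i satisfying P, is summable as
-- formal power series, with sum F.  That is, for each monomial all but
-- finitely many members have coefficient zero there, and the remaining
-- coefficients add up to that of F.  The list L (without repetitions)
-- need only contain all indices with nonzero coefficient; it may contain
-- others satisfying P.  Such an F is unique up to pointwise equality.
HasSum : {I : Set} → (I → Set) → (I → Series) → Series → Set
HasSum {I} P f F = ∀ a n → ∃[ L ]
    Unique L
  × All P L
  × (∀ i → P i → i ∉ L → f i a n ≡ 0ℤ)
  × sumℤ (map (λ i → f i a n) L) ≡ F a n

{-# OPTIONS --safe #-}

-- Read a partition by the multiplicities of 1, 2, 3, ….  The parts exceeding v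
-- are constrained by the smaller ones only through one of five states, so the
-- generating functions of the states satisfy a system of q-difference equations
-- relating parts ≥ v to parts ≥ v + 1.  Put
--
--   S(a,b,c) = Σ x^N q^(N(N-1)/2 + j² + ai + bj + ck) / ((q;q)ᵢ (q²;q²)ⱼ (q³;q³)ₖ).
--
-- The system is solved by φ(x) = S(1,2,2), φ(xq²), φ(xq³), and amounts to the
-- single equation
--
--   φ(x) = (1 + xq) φ(xq) + x²q⁴ (1 + xq) φ(xq³) - x⁴q⁹ φ(xq⁴),
--
-- which follows from the contiguous relations of S obtained by shifting i, j or k
-- by one.  The right-hand side of the theorem is φ(x) + x²q² φ(xq²) - x³q⁵ φ(xq³).
module Submission where

open import Defs
open import Algebra.Bundles using (CommutativeRing)
import Algebra.Construct.Pointwise as Pointwise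
import Algebra.Properties.CommutativeSemigroup as CommutativeSemigroupProperties
import Algebra.Properties.Semiring.Exp as Exp
import Algebra.Solver.Ring.NaturalCoefficients.Default as Solver
open import Algebra.Structures using (IsCommutativeRing)
open import Data.Bool.Base using (T; true; false; if_then_else_; _∧_)
open import Data.Empty using (⊥; ⊥-elim)
open import Data.Fin.Base using (toℕ) renaming (zero to fzero; suc to fsuc)
import Data.Integer.Base as ℤ
open ℤ using (ℤ; 0ℤ; 1ℤ; +_)
open import Data.Integer.Divisibility using () renaming (_∣_ to _∣ℤ_)
import Data.Integer.Properties as ℤ
open import Data.List.Base using (List; []; _∷_; _++_; map; length; lookup; applyUpTo; upTo; cartesianProduct)
open import Data.List.Membership.Propositional using (_∈_; _∉_)
open import Data.List.Membership.Propositional.Properties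
  using (∈-map⁺; ∈-++⁺ˡ; ∈-++⁺ʳ; ∈-cartesianProduct⁺; ∈-upTo⁺)
open import Data.List.Properties using (length-map; length-++; map-++; map-∘; map-applyUpTo; ∷-injectiveʳ)
open import Data.List.Relation.Binary.Infix.Heterogeneous using (here; there)
open import Data.List.Relation.Binary.Prefix.Heterogeneous using ([]; _∷_)
open import Data.List.Relation.Unary.All as All using (All; []; _∷_)
import Data.List.Relation.Unary.All.Properties as All
open import Data.List.Relation.Unary.AllPairs using ([]; _∷_)
open import Data.List.Relation.Unary.Any using (here; there)
open import Data.List.Relation.Unary.Linked using (Linked; []; [-]; _∷_)
open import Data.List.Relation.Unary.Unique.Propositional using (Unique)
import Data.List.Relation.Unary.Unique.Propositional.Properties as Unique
open import Data.Nat.Base as ℕ using (ℕ; zero; suc; _≤_; _<_; z≤n; s≤s; _≡ᵇ_)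
open import Data.Nat.Divisibility using (_∣_; ∣m+n∣m⇒∣n; >⇒∤; m∣m*n)
open import Data.Nat.DivMod using (m*n/n≡m)
open import Data.Nat.ListAction using (sum)
import Data.Nat.Properties as ℕ
open import Data.Nat.Tactic.RingSolver using (solve-∀)
open import Data.Product.Base using (_×_; _,_; ∃-syntax; proj₁; proj₂)
open import Data.Sum.Base using (_⊎_; inj₁; inj₂; [_,_]′)
open import Data.Unit.Base using (⊤; tt)
open import Function.Base using (_∘_; id)
import Relation.Binary.Reasoning.Setoid as SetoidReasoning
open import Relation.Nullary.Decidable using (yes; no)
open import Relation.Nullary.Negation using (¬_)
open import Relation.Unary using (U; _∪_)

-- Power series in one variable over a commutative ring

-- The formulas for the states come from subtracting equations whose transitions agree. Take v = 1,
-- so that passing to v + 1 replaces x by xq. From `double` one can only pass to `once`, hence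
-- double(x) = once(xq). The states `free` and `once` differ only in whether two copies of v may
-- follow, hence free = once + x²q² once(xq²); in the same way single = pair + x²q² once(xq²).
-- Finally, free - single is xq times the value of single - pair at xq, that is, x³q⁵ once(xq³). So
-- every state is a combination of shifts of `once`, and the equation of `once` turns into the
-- equation stated for φ.
--
-- The solution is identified with the counting series by induction: fix a bound on the size and
-- raise v. When v reaches the bound only the empty partition is left, and every series of a live
-- state is 1 modulo q^v.
--
-- The ring solver is that of commutative semirings. Identities with a minus sign are therefore
-- stated with the negative term moved across, or with -f as an atom of its own that is cancelled by
-- hand.

module PowerSeries {c ℓ} (R : CommutativeRing c ℓ) where
  open CommutativeRing R hiding (zero)
  open CommutativeSemigroupProperties +-commutativeSemigroup using (interchange; x∙yz≈y∙xz)
  open SetoidReasoning setoid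

  infixl 7 _⋆_

  -- Peeling off the leading coefficient of f avoids truncated subtraction of indices and makes
  -- every law a structural induction. The trailing `0#` mirrors the end of the `foldr` in `sumℤ`.
  _⋆_ : (f g : ℕ → Carrier) → ℕ → Carrier
  (f ⋆ g) zero    = f 0 * g 0 + 0#
  (f ⋆ g) (suc n) = f 0 * g (suc n) + (f ∘ suc ⋆ g) n

  one : ℕ → Carrier
  one zero    = 1#
  one (suc _) = 0#

  ⋆-cong : ∀ {f f′ g g′} → (∀ n → f n ≈ f′ n) → (∀ n → g n ≈ g′ n) →
           ∀ n → (f ⋆ g) n ≈ (f′ ⋆ g′) n
  ⋆-cong p r zero    = +-congʳ (*-cong (p 0) (r 0))
  ⋆-cong p r (suc n) = +-cong (*-cong (p 0) (r (suc n))) (⋆-cong (p ∘ suc) r n)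

  ⋆-distribʳ : ∀ h f g n → ((λ m → f m + g m) ⋆ h) n ≈ (f ⋆ h) n + (g ⋆ h) n
  ⋆-distribʳ h f g zero = begin
    (f 0 + g 0) * h 0 + 0#                    ≈⟨ +-cong (distribʳ _ _ _) (sym (+-identityˡ 0#)) ⟩
    (f 0 * h 0 + g 0 * h 0) + (0# + 0#)       ≈⟨ interchange _ _ _ _ ⟩
    (f ⋆ h) zero + (g ⋆ h) zero               ∎
  ⋆-distribʳ h f g (suc n) = begin
    (f 0 + g 0) * h (suc n) + ((λ m → f (suc m) + g (suc m)) ⋆ h) n
      ≈⟨ +-cong (distribʳ _ _ _) (⋆-distribʳ h (f ∘ suc) (g ∘ suc) n) ⟩
    (f 0 * h (suc n) + g 0 * h (suc n)) + ((f ∘ suc ⋆ h) n + (g ∘ suc ⋆ h) n)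
      ≈⟨ interchange _ _ _ _ ⟩
    (f ⋆ h) (suc n) + (g ⋆ h) (suc n) ∎

  ⋆-scaleˡ : ∀ a f g n → ((λ m → a * f m) ⋆ g) n ≈ a * (f ⋆ g) n
  ⋆-scaleˡ a f g zero = begin
    a * f 0 * g 0 + 0#           ≈⟨ +-cong (*-assoc _ _ _) (sym (zeroʳ a)) ⟩
    a * (f 0 * g 0) + a * 0#     ≈⟨ distribˡ _ _ _ ⟨
    a * (f 0 * g 0 + 0#)         ∎
  ⋆-scaleˡ a f g (suc n) = begin
    a * f 0 * g (suc n) + ((λ m → a * f (suc m)) ⋆ g) n ≈⟨ +-cong (*-assoc _ _ _) (⋆-scaleˡ a (f ∘ suc) g n) ⟩
    a * (f 0 * g (suc n)) + a * (f ∘ suc ⋆ g) n         ≈⟨ distribˡ _ _ _ ⟨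
    a * (f ⋆ g) (suc n) ∎

  ⋆-zeroˡ : ∀ g n → ((λ _ → 0#) ⋆ g) n ≈ 0#
  ⋆-zeroˡ g zero    = trans (+-congʳ (zeroˡ _)) (+-identityˡ 0#)
  ⋆-zeroˡ g (suc n) = trans (+-cong (zeroˡ _) (⋆-zeroˡ g n)) (+-identityˡ 0#)

  ⋆-identityˡ : ∀ g n → (one ⋆ g) n ≈ g n
  ⋆-identityˡ g zero    = trans (+-identityʳ _) (*-identityˡ _)
  ⋆-identityˡ g (suc n) = trans (+-cong (*-identityˡ _) (⋆-zeroˡ g n)) (+-identityʳ _)

  -- The mirror image of the defining recursion, peeling off the leading coefficient of the second
  -- factor; with it commutativity is an immediate induction.
  ⋆-unfoldʳ : ∀ f g n → (f ⋆ g) (suc n) ≈ g 0 * f (suc n) + (f ⋆ g ∘ suc) n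
  ⋆-unfoldʳ f g zero = begin
    f 0 * g 1 + (f 1 * g 0 + 0#) ≈⟨ +-cong (sym (+-identityʳ _)) (trans (+-identityʳ _) (*-comm _ _)) ⟩
    (f 0 * g 1 + 0#) + g 0 * f 1 ≈⟨ +-comm _ _ ⟩
    g 0 * f 1 + (f 0 * g 1 + 0#) ∎
  ⋆-unfoldʳ f g (suc n) = begin
    f 0 * g (suc (suc n)) + (f ∘ suc ⋆ g) (suc n)
      ≈⟨ +-congˡ (⋆-unfoldʳ (f ∘ suc) g n) ⟩
    f 0 * g (suc (suc n)) + (g 0 * f (suc (suc n)) + (f ∘ suc ⋆ g ∘ suc) n)
      ≈⟨ x∙yz≈y∙xz _ _ _ ⟩
    g 0 * f (suc (suc n)) + (f ⋆ g ∘ suc) (suc n) ∎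

  ⋆-comm : ∀ f g n → (f ⋆ g) n ≈ (g ⋆ f) n
  ⋆-comm f g zero    = +-congʳ (*-comm _ _)
  ⋆-comm f g (suc n) = trans (⋆-unfoldʳ f g n) (+-congˡ (⋆-comm f (g ∘ suc) n))

  ⋆-assoc : ∀ f g h n → (f ⋆ g ⋆ h) n ≈ (f ⋆ (g ⋆ h)) n
  ⋆-assoc f g h zero = +-congʳ (begin
    (f 0 * g 0 + 0#) * h 0 ≈⟨ *-congʳ (+-identityʳ _) ⟩
    f 0 * g 0 * h 0        ≈⟨ *-assoc _ _ _ ⟩
    f 0 * (g 0 * h 0)      ≈⟨ *-congˡ (+-identityʳ _) ⟨
    f 0 * (g 0 * h 0 + 0#) ∎)
  ⋆-assoc f g h (suc n) = begin
    (f ⋆ g) 0 * h (suc n) + ((f ⋆ g) ∘ suc ⋆ h) n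
      ≈⟨ +-cong (trans (*-congʳ (+-identityʳ _)) (*-assoc _ _ _))
                (⋆-distribʳ h (λ m → f 0 * g (suc m)) (f ∘ suc ⋆ g) n) ⟩
    f 0 * (g 0 * h (suc n)) + (((λ m → f 0 * g (suc m)) ⋆ h) n + (f ∘ suc ⋆ g ⋆ h) n)
      ≈⟨ +-congˡ (+-cong (⋆-scaleˡ (f 0) (g ∘ suc) h n) (⋆-assoc (f ∘ suc) g h n)) ⟩
    f 0 * (g 0 * h (suc n)) + (f 0 * (g ∘ suc ⋆ h) n + (f ∘ suc ⋆ (g ⋆ h)) n)
      ≈⟨ +-assoc _ _ _ ⟨
    f 0 * (g 0 * h (suc n)) + f 0 * (g ∘ suc ⋆ h) n + (f ∘ suc ⋆ (g ⋆ h)) n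
      ≈⟨ +-congʳ (distribˡ _ _ _) ⟨
    (f ⋆ (g ⋆ h)) (suc n) ∎

  monomial : Carrier → ℕ → ℕ → Carrier
  monomial c k n = if n ≡ᵇ k then c else 0#

  monomial-⋆-shift : ∀ c k g n → (monomial c k ⋆ g) (k ℕ.+ n) ≈ c * g n
  monomial-⋆-shift c zero    g zero    = +-identityʳ _
  monomial-⋆-shift c zero    g (suc n) = trans (+-congˡ (⋆-zeroˡ g n)) (+-identityʳ _)
  monomial-⋆-shift c (suc k) g n =
    trans (+-cong (zeroˡ _) (monomial-⋆-shift c k g n)) (+-identityˡ _)

  monomial-⋆-low : ∀ c k g {n} → n < k → (monomial c k ⋆ g) n ≈ 0#
  monomial-⋆-low c (suc k) g {zero}  _         = trans (+-identityʳ _) (zeroˡ _)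
  monomial-⋆-low c (suc k) g {suc n} (s≤s n<k) =
    trans (+-cong (zeroˡ _) (monomial-⋆-low c k g n<k)) (+-identityˡ _)

  commutativeRing : CommutativeRing c ℓ
  commutativeRing = record
    { Carrier = ℕ → Carrier
    ; _≈_ = λ f g → ∀ n → f n ≈ g n
    ; _+_ = λ f g n → f n + g n
    ; _*_ = _⋆_
    ; -_  = λ f n → - f n
    ; 0#  = λ _ → 0#
    ; 1#  = one
    ; isCommutativeRing = record
      { isRing = record
        { +-isAbelianGroup = Pointwise.isAbelianGroup ℕ +-isAbelianGroup
        ; *-cong = ⋆-cong
        ; *-assoc = ⋆-assoc
        ; *-identity = ⋆-identityˡ , λ f n → trans (⋆-comm f one n) (⋆-identityˡ f n)
        ; distrib =
            (λ f g h n → trans (⋆-comm f (λ m → g m + h m) n)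
              (trans (⋆-distribʳ f g h n) (+-cong (⋆-comm g f n) (⋆-comm h f n))))
          , ⋆-distribʳ
        }
      ; *-comm = ⋆-comm
      }
    }

open import Data.Nat.Base using (_+_; _*_; _∸_; _/_; _^_)
open import Relation.Binary.PropositionalEquality
  using (_≡_; _≢_; refl; sym; trans; cong; cong₂; subst; module ≡-Reasoning)
open CommutativeSemigroupProperties ℤ.+-commutativeSemigroup using ()
  renaming (interchange to ℤ-interchange)

-- Finite sums and coefficients of products

sum-cong : ∀ {g h : ℕ → ℤ} n → (∀ i → i < n → g i ≡ h i) →
           sumℤ (applyUpTo g n) ≡ sumℤ (applyUpTo h n)
sum-cong zero    p = refl
sum-cong (suc n) p = cong₂ ℤ._+_ (p 0 ℕ.z<s) (sum-cong n (λ i i<n → p (suc i) (s≤s i<n)))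

sum-zero : ∀ {h : ℕ → ℤ} n → (∀ i → i < n → h i ≡ 0ℤ) → sumℤ (applyUpTo h n) ≡ 0ℤ
sum-zero zero    p = refl
sum-zero (suc n) p = cong₂ ℤ._+_ (p 0 ℕ.z<s) (sum-zero n (λ i i<n → p (suc i) (s≤s i<n)))

sum-extend : ∀ {h : ℕ → ℤ} {m n} → m ≤ n → (∀ i → m ≤ i → h i ≡ 0ℤ) →
             sumℤ (applyUpTo h n) ≡ sumℤ (applyUpTo h m)
sum-extend {n = n} z≤n p = sum-zero n (λ i _ → p i z≤n)
sum-extend {h = h} (s≤s m≤n) p = cong (ℤ._+_ (h 0)) (sum-extend m≤n (λ i m≤i → p (suc i) (s≤s m≤i)))

⊛-zero : ∀ f g a n → (∀ b m → b ≤ a → m ≤ n → f b m ℤ.* g (a ∸ b) (n ∸ m) ≡ 0ℤ) →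
         (f ⊛ g) a n ≡ 0ℤ
⊛-zero f g a n p = sum-zero (suc a) λ b b≤a → sum-zero (suc n) λ m m≤n →
  p b m (ℕ.≤-pred b≤a) (ℕ.≤-pred m≤n)

⊛-congʳ-at : ∀ f {g h} a n → (∀ b m → b ≤ a → m ≤ n → g b m ≡ h b m) →
             (f ⊛ g) a n ≡ (f ⊛ h) a n
⊛-congʳ-at f a n p = sum-cong (suc a) λ b _ → sum-cong (suc n) λ m _ →
  cong (f b m ℤ.*_) (p (a ∸ b) (n ∸ m) (ℕ.m∸n≤m a b) (ℕ.m∸n≤m n m))

-- The ring of power series in x and q

module ℤ⟦q⟧ where
  open PowerSeries ℤ.+-*-commutativeRing public

-- A `Series` takes the exponent of x first, so it is a power series in x with coefficients in
-- ℤ[[q]]: the one-variable construction applied twice.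
module ℤ⟦q⟧⟦x⟧ where
  open PowerSeries ℤ⟦q⟧.commutativeRing public
  open CommutativeRing commutativeRing public

⊛≡⋆ : ∀ f g a n → (f ⊛ g) a n ≡ (f ℤ⟦q⟧⟦x⟧.⋆ g) a n
⊛≡⋆ f g a n = outer f a
  where
  inner : ∀ (u w : ℕ → ℤ) n →
          sumℤ (applyUpTo (λ m → u m ℤ.* w (n ∸ m)) (suc n)) ≡ (u ℤ⟦q⟧.⋆ w) n
  inner u w zero    = refl
  inner u w (suc n) = cong (ℤ._+_ (u 0 ℤ.* w (suc n))) (inner (u ∘ suc) w n)

  outer : ∀ f a → (f ⊛ g) a n ≡ (f ℤ⟦q⟧⟦x⟧.⋆ g) a n
  outer f zero    = cong (λ z → z ℤ.+ 0ℤ) (inner (f 0) (g 0) n)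
  outer f (suc a) = cong₂ ℤ._+_ (inner (f 0) (g (suc a)) n) (outer (f ∘ suc) a)

x^q^≡monomial : ∀ α β a n → (x^ α q^ β) a n ≡ ℤ⟦q⟧⟦x⟧.monomial (ℤ⟦q⟧.monomial 1ℤ β) α a n
x^q^≡monomial α β a n with a ≡ᵇ α
... | true  = refl
... | false = refl

𝟙≡one : ∀ a n → 𝟙 a n ≡ ℤ⟦q⟧⟦x⟧.one a n
𝟙≡one zero    zero    = refl
𝟙≡one zero    (suc n) = refl
𝟙≡one (suc a) n       = refl

infix 4 _≈_
-- A record instead of a bare function type, so that unification can recover f and g from the type
-- of a proof.
record _≈_ (f g : Series) : Set where
  constructor coeffwise
  field at : ∀ a n → f a n ≡ g a n
open _≈_ public

-- Opaque copies of the operations of Defs, so that unification treats them as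
-- rigid symbols instead of unfolding them to sums over lists.
opaque
  infixl 6 _+ˢ_
  infixl 7 _·_

  _+ˢ_ _·_ : Series → Series → Series
  _+ˢ_ = _⊕_
  _·_  = _⊛_

  -ˢ_ : Series → Series
  (-ˢ f) a n = ℤ.- f a n

  0ˢ : Series
  0ˢ _ _ = 0ℤ

opaque
  unfolding _+ˢ_

  +ˢ-at : ∀ f g a n → (f +ˢ g) a n ≡ f a n ℤ.+ g a n
  +ˢ-at f g a n = refl

  0ˢ-at : ∀ a n → 0ˢ a n ≡ 0ℤ
  0ˢ-at a n = refl

  ⊛≈· : ∀ f g → f ⊛ g ≈ f · g
  ⊛≈· f g = coeffwise λ a n → refl

  -- Addition is that of the iterated power series ring on the nose; the laws of the product are
  -- transported along `⊛≡⋆`.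
  +ˢ-·-isCommutativeRing : IsCommutativeRing _≈_ _+ˢ_ _·_ -ˢ_ 0ˢ 𝟙
  +ˢ-·-isCommutativeRing = record
    { isRing = record
      { +-isAbelianGroup = record
        { isGroup = record
          { isMonoid = record
            { isSemigroup = record
              { isMagma = record
                { isEquivalence = record
                  { refl  = coeffwise λ _ _ → refl
                  ; sym   = λ p → coeffwise λ a n → sym (at p a n)
                  ; trans = λ p r → coeffwise λ a n → trans (at p a n) (at r a n)
                  }
                ; ∙-cong = λ p r → coeffwise λ a n → cong₂ ℤ._+_ (at p a n) (at r a n)
                }
              ; assoc = λ f g h → coeffwise (S.+-assoc f g h)
              }
            ; identity = (λ f → coeffwise (S.+-identityˡ f)) , (λ f → coeffwise (S.+-identityʳ f))
            }
          ; inverse = (λ f → coeffwise (S.-‿inverseˡ f)) , (λ f → coeffwise (S.-‿inverseʳ f))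
          ; ⁻¹-cong = λ p → coeffwise λ a n → cong ℤ.-_ (at p a n)
          }
        ; comm = λ f g → coeffwise (S.+-comm f g)
        }
      ; *-cong = λ {f} {f′} {g} {g′} p r → via f g f′ g′ (S.*-cong {f} {f′} {g} {g′} (at p) (at r))
      ; *-assoc = λ f g h → coeffwise λ a n →
          trans (⊛≡⋆ (f ⊛ g) h a n) (trans (S.*-cong {f ⊛ g} {f S.* g} {h} {h} (⊛≡⋆ f g) (λ _ _ → refl) a n)
          (trans (S.*-assoc f g h a n)
          (sym (trans (⊛≡⋆ f (g ⊛ h) a n) (S.*-cong {f} {f} {g ⊛ h} {g S.* h} (λ _ _ → refl) (⊛≡⋆ g h) a n)))))
      ; *-identity = (λ f → idˡ f) , λ f → coeffwise λ a n → trans (at (comm′ f 𝟙) a n) (at (idˡ f) a n)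
      ; distrib = (λ f g h → coeffwise λ a n → trans (⊛≡⋆ f (g ⊕ h) a n) (trans (S.distribˡ f g h a n)
                     (sym (cong₂ ℤ._+_ (⊛≡⋆ f g a n) (⊛≡⋆ f h a n)))))
                , (λ f g h → coeffwise λ a n → trans (⊛≡⋆ (g ⊕ h) f a n) (trans (S.distribʳ f g h a n)
                     (sym (cong₂ ℤ._+_ (⊛≡⋆ g f a n) (⊛≡⋆ h f a n)))))
      }
    ; *-comm = comm′
    }
    where
    module S = ℤ⟦q⟧⟦x⟧

    via : ∀ f g f′ g′ → (∀ a n → (f S.* g) a n ≡ (f′ S.* g′) a n) → f ⊛ g ≈ f′ ⊛ g′
    via f g f′ g′ p = coeffwise λ a n → trans (⊛≡⋆ f g a n) (trans (p a n) (sym (⊛≡⋆ f′ g′ a n)))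

    comm′ : ∀ f g → f ⊛ g ≈ g ⊛ f
    comm′ f g = via f g g f (S.*-comm f g)

    idˡ : ∀ f → 𝟙 ⊛ f ≈ f
    idˡ f = coeffwise λ a n → trans (⊛≡⋆ 𝟙 f a n)
      (trans (S.*-cong {𝟙} {S.1#} {f} {f} 𝟙≡one (λ _ _ → refl) a n) (S.*-identityˡ f a n))

  x^q^-shift : ∀ α β f a n → ((x^ α q^ β) · f) (α + a) (β + n) ≡ f a n
  x^q^-shift α β f a n = begin
    ((x^ α q^ β) ⊛ f) (α + a) (β + n)                        ≡⟨ ⊛≡⋆ (x^ α q^ β) f (α + a) (β + n) ⟩
    ((x^ α q^ β) S.⋆ f) (α + a) (β + n)
      ≡⟨ S.⋆-cong {x^ α q^ β} {S.monomial u α} {f} {f} (x^q^≡monomial α β) (λ _ _ → refl) (α + a) (β + n) ⟩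
    (S.monomial u α S.⋆ f) (α + a) (β + n)                   ≡⟨ S.monomial-⋆-shift u α f a (β + n) ⟩
    (u ℤ⟦q⟧.⋆ f a) (β + n)                                   ≡⟨ ℤ⟦q⟧.monomial-⋆-shift 1ℤ β (f a) n ⟩
    1ℤ ℤ.* f a n                                             ≡⟨ ℤ.*-identityˡ _ ⟩
    f a n                                                    ∎
    where
    open ≡-Reasoning
    module S = ℤ⟦q⟧⟦x⟧
    u : ℕ → ℤ
    u = ℤ⟦q⟧.monomial 1ℤ β

seriesRing : CommutativeRing _ _
seriesRing = record { isCommutativeRing = +ˢ-·-isCommutativeRing }

-- Multiplication by monomials

≡ᵇ-<-false : ∀ {m n} → m < n → (m ≡ᵇ n) ≡ false
≡ᵇ-<-false {zero}  (s≤s _)   = refl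
≡ᵇ-<-false {suc m} (s≤s m<n) = ≡ᵇ-<-false m<n

≡ᵇ-+ : ∀ k m n → (k + m ≡ᵇ k + n) ≡ (m ≡ᵇ n)
≡ᵇ-+ zero    m n = refl
≡ᵇ-+ (suc k) m n = ≡ᵇ-+ k m n

x^q^-zero : ∀ α β {a n} → a < α ⊎ n < β → (x^ α q^ β) a n ≡ 0ℤ
x^q^-zero α β (inj₁ a<α) rewrite ≡ᵇ-<-false a<α = refl
x^q^-zero α β {a} {n} (inj₂ n<β) rewrite ≡ᵇ-<-false {n} {β} n<β with a ≡ᵇ α
... | true  = refl
... | false = refl

opaque
  unfolding _+ˢ_

  x^q^-·-zero : ∀ α β f {a n} → a < α ⊎ n < β → ((x^ α q^ β) · f) a n ≡ 0ℤ
  x^q^-·-zero α β f {a} {n} p = ⊛-zero (x^ α q^ β) f a n λ b m b≤a m≤n →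
    trans (cong (ℤ._* f (a ∸ b) (n ∸ m)) (x^q^-zero α β (low b≤a m≤n p))) (ℤ.*-zeroˡ (f (a ∸ b) (n ∸ m)))
    where
    low : ∀ {b m} → b ≤ a → m ≤ n → a < α ⊎ n < β → b < α ⊎ m < β
    low b≤a m≤n (inj₁ a<α) = inj₁ (ℕ.≤-<-trans b≤a a<α)
    low b≤a m≤n (inj₂ n<β) = inj₂ (ℕ.≤-<-trans m≤n n<β)

-- The two cases for a coefficient of a monomial multiple: below the exponent it vanishes, above it
-- the coefficient is a shifted one.
data Position (k : ℕ) : ℕ → Set where
  below : ∀ {n} → n < k → Position k n
  above : ∀ n → Position k (k + n)

position : ∀ k n → Position k n
position k n with n ℕ.<? k
... | yes n<k = below n<k
... | no  n≮k = subst (Position k) (ℕ.m+[n∸m]≡n (ℕ.≮⇒≥ n≮k)) (above (n ∸ k))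

x^q^-· : ∀ α β α′ β′ → (x^ α q^ β) · (x^ α′ q^ β′) ≈ x^ (α + α′) q^ (β + β′)
x^q^-· α β α′ β′ = coeffwise λ a n → coefficient (position α a) (position β n)
  where
  coefficient : ∀ {a n} → Position α a → Position β n →
                ((x^ α q^ β) · (x^ α′ q^ β′)) a n ≡ (x^ (α + α′) q^ (β + β′)) a n
  coefficient {n = n} (below a<α) _ = trans (x^q^-·-zero α β _ {n = n} (inj₁ a<α))
    (sym (x^q^-zero (α + α′) (β + β′) {n = n} (inj₁ (ℕ.m≤n⇒m≤n+o α′ a<α))))
  coefficient (above a) (below n<β) = trans (x^q^-·-zero α β _ {α + a} (inj₂ n<β))
    (sym (x^q^-zero (α + α′) (β + β′) {α + a} (inj₂ (ℕ.m≤n⇒m≤n+o β′ n<β))))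
  coefficient (above a) (above n) = trans (x^q^-shift α β _ a n)
    (sym (cong₂ (λ s t → if s ∧ t then 1ℤ else 0ℤ) (≡ᵇ-+ α a α′) (≡ᵇ-+ β n β′)))

module Ring = CommutativeRing seriesRing
open Solver Ring.commutativeSemiring using (solve; _:=_; _:+_; _:*_; _:^_; con)
open Exp Ring.semiring using () renaming (_^_ to _^ˢ_; ^-congˡ to ^ˢ-congˡ)
module ≈-Reasoning = SetoidReasoning Ring.setoid

·-congʳ-at : ∀ f {g h} a n → (∀ b m → b ≤ a → g b m ≡ h b m) → (f · g) a n ≡ (f · h) a n
·-congʳ-at f {g} {h} a n p = begin
  (f · g) a n ≡⟨ at (⊛≈· f g) a n ⟨
  (f ⊛ g) a n ≡⟨ ⊛-congʳ-at f a n (λ b m b≤a _ → p b m b≤a) ⟩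
  (f ⊛ h) a n ≡⟨ at (⊛≈· f h) a n ⟩
  (f · h) a n ∎
  where open ≡-Reasoning

-- Sums that converge in the x-adic topology

partialSum : (ℕ → Series) → ℕ → Series
partialSum h K a n = sumℤ (applyUpTo (λ i → h i a n) K)

partialSum-suc : ∀ h K → partialSum h (suc K) ≈ h 0 +ˢ partialSum (h ∘ suc) K
partialSum-suc h K = coeffwise λ a n → sym (+ˢ-at (h 0) _ a n)

partialSum-cong : ∀ {g h} K → (∀ i → g i ≈ h i) → partialSum g K ≈ partialSum h K
partialSum-cong K p = coeffwise λ a n → sum-cong K (λ i _ → at (p i) a n)

·-partialSum : ∀ u h K → u · partialSum h K ≈ partialSum (λ i → u · h i) K
·-partialSum u h zero = begin
  u · partialSum h 0 ≈⟨ Ring.*-congˡ (coeffwise λ a n → sym (0ˢ-at a n)) ⟩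
  u · 0ˢ             ≈⟨ Ring.zeroʳ u ⟩
  0ˢ                 ≈⟨ coeffwise 0ˢ-at ⟩
  partialSum (λ i → u · h i) 0 ∎
  where open ≈-Reasoning
·-partialSum u h (suc K) = begin
  u · partialSum h (suc K)                              ≈⟨ Ring.*-congˡ (partialSum-suc h K) ⟩
  u · (h 0 +ˢ partialSum (h ∘ suc) K)                   ≈⟨ Ring.distribˡ _ _ _ ⟩
  u · h 0 +ˢ u · partialSum (h ∘ suc) K                 ≈⟨ Ring.+-congˡ (·-partialSum u (h ∘ suc) K) ⟩
  u · h 0 +ˢ partialSum (λ i → u · h (suc i)) K         ≈⟨ partialSum-suc (λ i → u · h i) K ⟨
  partialSum (λ i → u · h i) (suc K)                    ∎
  where open ≈-Reasoning

partialSum-+ : ∀ g h K → partialSum (λ i → g i +ˢ h i) K ≈ partialSum g K +ˢ partialSum h K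
partialSum-+ g h K = coeffwise λ a n → trans (coefficient g h K a n) (sym (+ˢ-at _ _ a n))
  where
  coefficient : ∀ g h K a n → partialSum (λ i → g i +ˢ h i) K a n ≡ partialSum g K a n ℤ.+ partialSum h K a n
  coefficient g h zero    a n = refl
  coefficient g h (suc K) a n = trans
    (cong₂ ℤ._+_ (+ˢ-at (g 0) (h 0) a n) (coefficient (g ∘ suc) (h ∘ suc) K a n))
    (ℤ-interchange (g 0 a n) (h 0 a n) _ _)

-- Divisibility by x^p.
XOrder : ℕ → Series → Set
XOrder p f = ∀ {a} n → a < p → f a n ≡ 0ℤ

XOrder-≤ : ∀ {p r f} → p ≤ r → XOrder r f → XOrder p f
XOrder-≤ p≤r o n a<p = o n (ℕ.<-≤-trans a<p p≤r)

XOrder-x^q^-· : ∀ α β f → XOrder α ((x^ α q^ β) · f)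
XOrder-x^q^-· α β f n a<α = x^q^-·-zero α β f {n = n} (inj₁ a<α)

-- Truncating at i ≤ a computes the coefficient of xᵃ only if xⁱ divides h i.
∑ : (ℕ → Series) → Series
∑ h a n = partialSum h (suc a) a n

∑-partialSum : ∀ h → (∀ i → XOrder i (h i)) → ∀ {K a} n → a < K → partialSum h K a n ≡ ∑ h a n
∑-partialSum h o n a<K = sum-extend a<K λ i a<i → o i n a<i

∑-XOrder : ∀ {p} h → (∀ i → XOrder p (h i)) → XOrder p (∑ h)
∑-XOrder h o {a} n a<p = sum-zero (suc a) (λ i _ → o i n a<p)

∑-cong : ∀ {g h} → (∀ i → g i ≈ h i) → ∑ g ≈ ∑ h
∑-cong p = coeffwise λ a n → at (partialSum-cong (suc a) p) a n

·-∑ : ∀ u h → (∀ i → XOrder i (h i)) → ∀ {K a} n → a < K →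
      partialSum (λ i → u · h i) K a n ≡ (u · ∑ h) a n
·-∑ u h o {K} {a} n a<K = begin
  partialSum (λ i → u · h i) K a n ≡⟨ at (·-partialSum u h K) a n ⟨
  (u · partialSum h K) a n         ≡⟨ ·-congʳ-at u a n (λ b m b≤a → ∑-partialSum h o m (ℕ.≤-<-trans b≤a a<K)) ⟩
  (u · ∑ h) a n                    ∎
  where open ≡-Reasoning

-- The sums of f and g are cut off at the same index, but u · ∑ h involves coefficients of ∑ h in
-- lower degrees of x, where the cut-off comes earlier. The order of h makes the difference vanish.
∑-linear : ∀ {f g h u} → (∀ i → f i ≈ g i +ˢ u · h i) → (∀ i → XOrder i (h i)) →
           ∑ f ≈ ∑ g +ˢ u · ∑ h
∑-linear {f} {g} {h} {u} p o = coeffwise λ a n → begin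
  ∑ f a n                                                       ≡⟨ at (partialSum-cong (suc a) p) a n ⟩
  partialSum (λ i → g i +ˢ u · h i) (suc a) a n                 ≡⟨ at (partialSum-+ g (λ i → u · h i) (suc a)) a n ⟩
  (partialSum g (suc a) +ˢ partialSum (λ i → u · h i) (suc a)) a n ≡⟨ +ˢ-at (partialSum g (suc a)) _ a n ⟩
  ∑ g a n ℤ.+ partialSum (λ i → u · h i) (suc a) a n            ≡⟨ cong (ℤ._+_ (∑ g a n)) (·-∑ u h o n ℕ.≤-refl) ⟩
  ∑ g a n ℤ.+ (u · ∑ h) a n                                     ≡⟨ +ˢ-at (∑ g) _ a n ⟨
  (∑ g +ˢ u · ∑ h) a n                                          ∎
  where open ≡-Reasoning

-- Meant for contiguous relations, where raising an index by one leads back to h at the old index.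
-- Splitting off the term of index 0 moves the cut-off by one, which is compensated by the orders of
-- f and g.
∑-shift : ∀ {f g h u} → f 0 ≈ g 0 → (∀ i → f (suc i) ≈ g (suc i) +ˢ u · h i) →
          (∀ i → XOrder i (f i)) → (∀ i → XOrder i (g i)) → (∀ i → XOrder i (h i)) →
          ∑ f ≈ ∑ g +ˢ u · ∑ h
∑-shift {f} {g} {h} {u} p₀ p of og oh = coeffwise λ a n → begin
  ∑ f a n
    ≡⟨ ∑-partialSum f of n (ℕ.m<n⇒m<1+n ℕ.≤-refl) ⟨
  f 0 a n ℤ.+ partialSum (f ∘ suc) (suc a) a n
    ≡⟨ cong₂ ℤ._+_ (at p₀ a n) (at (partialSum-cong (suc a) p) a n) ⟩
  g 0 a n ℤ.+ partialSum (λ i → g (suc i) +ˢ u · h i) (suc a) a n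
    ≡⟨ cong (ℤ._+_ (g 0 a n)) (trans (at (partialSum-+ (g ∘ suc) (λ i → u · h i) (suc a)) a n) (+ˢ-at (partialSum (g ∘ suc) (suc a)) _ a n)) ⟩
  g 0 a n ℤ.+ (partialSum (g ∘ suc) (suc a) a n ℤ.+ partialSum (λ i → u · h i) (suc a) a n)
    ≡⟨ ℤ.+-assoc (g 0 a n) _ _ ⟨
  partialSum g (suc (suc a)) a n ℤ.+ partialSum (λ i → u · h i) (suc a) a n
    ≡⟨ cong₂ ℤ._+_ (∑-partialSum g og n (ℕ.m<n⇒m<1+n ℕ.≤-refl)) (·-∑ u h oh n ℕ.≤-refl) ⟩
  ∑ g a n ℤ.+ (u · ∑ h) a n
    ≡⟨ +ˢ-at (∑ g) _ a n ⟨
  (∑ g +ˢ u · ∑ h) a n ∎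
  where open ≡-Reasoning

-- Reciprocals

-- The filtration by total degree in x and q, the one by which `recip` is truncated.
VanishesBelow : ℕ → Series → Set
VanishesBelow p f = ∀ a n → a + n < p → f a n ≡ 0ℤ

-- The total degrees of two factors add up to a + n < p + r, so either the first is below p or the
-- second is below r.
⊛-vanishesBelow : ∀ {p r f g} → VanishesBelow p f → VanishesBelow r g → VanishesBelow (p + r) (f ⊛ g)
⊛-vanishesBelow {p} {r} {f} {g} vf vg a n a+n<p+r = ⊛-zero f g a n factor
  where
  factor : ∀ b m → b ≤ a → m ≤ n → f b m ℤ.* g (a ∸ b) (n ∸ m) ≡ 0ℤ
  factor b m b≤a m≤n with b + m ℕ.<? p
  ... | yes b+m<p = trans (cong (ℤ._* g (a ∸ b) (n ∸ m)) (vf b m b+m<p)) (ℤ.*-zeroˡ (g (a ∸ b) (n ∸ m)))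
  ... | no  b+m≮p = trans (cong (f b m ℤ.*_) (vg (a ∸ b) (n ∸ m) rest<r)) (ℤ.*-zeroʳ (f b m))
    where
    total : (b + m) + ((a ∸ b) + (n ∸ m)) ≡ a + n
    total = trans (lemma b m (a ∸ b) (n ∸ m)) (cong₂ _+_ (ℕ.m+[n∸m]≡n b≤a) (ℕ.m+[n∸m]≡n m≤n))
      where
      lemma : ∀ b m c k → (b + m) + (c + k) ≡ (b + c) + (m + k)
      lemma = solve-∀
    rest<r : (a ∸ b) + (n ∸ m) < r
    rest<r = ℕ.+-cancelˡ-< p _ _ (ℕ.≤-<-trans
      (ℕ.+-monoˡ-≤ ((a ∸ b) + (n ∸ m)) (ℕ.≮⇒≥ b+m≮p))
      (subst (_< p + r) (sym total) a+n<p+r))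

↑-vanishesBelow : ∀ {f} → VanishesBelow 1 f → ∀ k → VanishesBelow k (f ↑ k)
↑-vanishesBelow v zero    a n ()
↑-vanishesBelow v (suc k) = ⊛-vanishesBelow v (↑-vanishesBelow v k)

⊖-+ˢ : ∀ f g → (f ⊖ g) +ˢ g ≈ f
⊖-+ˢ f g = coeffwise λ a n → trans (+ˢ-at (f ⊖ g) g a n) (trans (ℤ.+-assoc (f a n) _ _)
  (trans (cong (ℤ._+_ (f a n)) (ℤ.+-inverseˡ (g a n))) (ℤ.+-identityʳ _)))

module _ (f : Series) (f₀₀ : f 0 0 ≡ 1ℤ) where
  private
    g : Series
    g = 𝟙 ⊖ f

    f+g≈𝟙 : f +ˢ g ≈ 𝟙
    f+g≈𝟙 = Ring.trans (Ring.+-comm f g) (⊖-+ˢ 𝟙 f)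

    powers : ∀ K → partialSum (λ k → g ↑ suc k) K ≈ g · partialSum (g ↑_) K
    powers K = Ring.trans (partialSum-cong K (λ k → ⊛≈· g (g ↑ k))) (Ring.sym (·-partialSum g (g ↑_) K))

    -- The telescoping f (1 + g + ... + g^(K-1)) = 1 - g^K for g = 1 - f, with the power moved to
    -- the left.
    geometric : ∀ K → f · partialSum (g ↑_) K +ˢ g ↑ K ≈ 𝟙
    geometric zero = begin
      f · partialSum (g ↑_) 0 +ˢ 𝟙  ≈⟨ Ring.+-congʳ (Ring.*-congˡ (coeffwise λ a n → sym (0ˢ-at a n))) ⟩
      f · 0ˢ +ˢ 𝟙                   ≈⟨ Ring.+-congʳ (Ring.zeroʳ f) ⟩
      0ˢ +ˢ 𝟙                       ≈⟨ Ring.+-identityˡ 𝟙 ⟩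
      𝟙                             ∎
      where open ≈-Reasoning
    geometric (suc K) = begin
      f · partialSum (g ↑_) (suc K) +ˢ g ↑ suc K
        ≈⟨ Ring.+-cong (Ring.*-congˡ (Ring.trans (partialSum-suc (g ↑_) K) (Ring.+-congˡ (powers K)))) (⊛≈· g (g ↑ K)) ⟩
      f · (𝟙 +ˢ g · S) +ˢ g · g ↑ K
        ≈⟨ Ring.+-congʳ (Ring.trans (Ring.distribˡ f 𝟙 (g · S)) (Ring.+-congʳ (Ring.*-identityʳ f))) ⟩
      f +ˢ f · (g · S) +ˢ g · g ↑ K
        ≈⟨ solve 4 (λ f g S z → f :+ f :* (g :* S) :+ g :* z := f :+ g :* (f :* S :+ z)) Ring.refl f g S (g ↑ K) ⟩
      f +ˢ g · (f · S +ˢ g ↑ K) ≈⟨ Ring.+-congˡ (Ring.trans (Ring.*-congˡ (geometric K)) (Ring.*-identityʳ g)) ⟩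
      f +ˢ g                    ≈⟨ f+g≈𝟙 ⟩
      𝟙 ∎
      where
      open ≈-Reasoning
      S : Series
      S = partialSum (g ↑_) K

    g-vanishes : VanishesBelow 1 g
    g-vanishes zero    zero    _       = trans (cong (λ z → 1ℤ ℤ.- z) f₀₀) refl
    g-vanishes zero    (suc n) (s≤s ())
    g-vanishes (suc a) n       (s≤s ())

  -- With K above a + n, `recip f` agrees with the partial sum in all degrees that contribute to the
  -- coefficient, and the remainder g^K has no term there.
  ·-recip : f · recip f ≈ 𝟙
  ·-recip = coeffwise λ a n → let K = suc (a + n) in begin
    (f · recip f) a n                         ≡⟨ at (⊛≈· f (recip f)) a n ⟨
    (f ⊛ recip f) a n                         ≡⟨ ⊛-congʳ-at f a n (truncate a n) ⟩
    (f ⊛ partialSum (g ↑_) K) a n             ≡⟨ at (⊛≈· f _) a n ⟩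
    (f · partialSum (g ↑_) K) a n             ≡⟨ ℤ.+-identityʳ _ ⟨
    (f · partialSum (g ↑_) K) a n ℤ.+ 0ℤ      ≡⟨ cong (ℤ._+_ ((f · partialSum (g ↑_) K) a n)) (↑-vanishesBelow g-vanishes K a n ℕ.≤-refl) ⟨
    (f · partialSum (g ↑_) K) a n ℤ.+ (g ↑ K) a n ≡⟨ +ˢ-at (f · partialSum (g ↑_) K) (g ↑ K) a n ⟨
    (f · partialSum (g ↑_) K +ˢ g ↑ K) a n    ≡⟨ at (geometric K) a n ⟩
    𝟙 a n                                     ∎
    where
    open ≡-Reasoning
    truncate : ∀ a n b m → b ≤ a → m ≤ n → recip f b m ≡ partialSum (g ↑_) (suc (a + n)) b m
    truncate a n b m b≤a m≤n = sym (sum-extend (s≤s (ℕ.+-mono-≤ b≤a m≤n))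
      λ k b+m<k → ↑-vanishesBelow g-vanishes k b m b+m<k)

⊛-00 : ∀ f g → (f ⊛ g) 0 0 ≡ f 0 0 ℤ.* g 0 0
⊛-00 f g = trans (ℤ.+-identityʳ _) (ℤ.+-identityʳ _)

x^0q^-↑ : ∀ d n → (x^ 0 q^ d) ↑ n ≈ x^ 0 q^ (n * d)
x^0q^-↑ d zero    = Ring.refl
x^0q^-↑ d (suc n) = Ring.trans (⊛≈· _ _) (Ring.trans (Ring.*-congˡ (x^0q^-↑ d n)) (x^q^-· 0 d 0 (n * d)))

-- The recursion of the Pochhammer symbol without subtraction. Since the base and the ratio are both
-- q^d, the new factor is 1 - q^(d(n+1)).
qpoch-suc : ∀ d n → qpoch d (suc n) +ˢ (x^ 0 q^ (suc n * d)) · qpoch d n ≈ qpoch d n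
qpoch-suc d n = begin
  qpoch d n ⊛ w +ˢ (x^ 0 q^ (suc n * d)) · qpoch d n
    ≈⟨ Ring.+-cong (⊛≈· _ _) (Ring.trans (Ring.*-comm _ _) (Ring.*-congˡ (Ring.sym (x^0q^-↑ d (suc n))))) ⟩
  qpoch d n · w +ˢ qpoch d n · (x^ 0 q^ d) ↑ suc n  ≈⟨ Ring.distribˡ _ _ _ ⟨
  qpoch d n · (w +ˢ (x^ 0 q^ d) ↑ suc n)             ≈⟨ Ring.*-congˡ (⊖-+ˢ 𝟙 _) ⟩
  qpoch d n · 𝟙                                      ≈⟨ Ring.*-identityʳ _ ⟩
  qpoch d n                                          ∎
  where
  open ≈-Reasoning
  w : Series
  w = 𝟙 ⊖ (x^ 0 q^ d) ↑ suc n

qpoch-00 : ∀ d n → qpoch (suc d) n 0 0 ≡ 1ℤ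
qpoch-00 d zero    = refl
qpoch-00 d (suc n) = begin
  qpoch (suc d) (suc n) 0 0                   ≡⟨ ⊛-00 (qpoch (suc d) n) (𝟙 ⊖ p) ⟩
  qpoch (suc d) n 0 0 ℤ.* (1ℤ ℤ.- p 0 0)
    ≡⟨ cong₂ (λ s t → s ℤ.* (1ℤ ℤ.- t)) (qpoch-00 d n) (at (x^0q^-↑ (suc d) (suc n)) 0 0) ⟩
  1ℤ ∎
  where
  open ≡-Reasoning
  p : Series
  p = (x^ 0 q^ suc d) ↑ suc n

denominator : ℕ → ℕ → ℕ → Series
denominator i j k = qpoch 1 i ⊛ qpoch 2 j ⊛ qpoch 3 k

denominator≈· : ∀ i j k → denominator i j k ≈ qpoch 1 i · qpoch 2 j · qpoch 3 k
denominator≈· i j k = Ring.trans (⊛≈· _ _) (Ring.*-congʳ (⊛≈· _ _))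

1/denominator : ℕ → ℕ → ℕ → Series
1/denominator i j k = recip (denominator i j k)

denominator-·-1/denominator : ∀ i j k → denominator i j k · 1/denominator i j k ≈ 𝟙
denominator-·-1/denominator i j k = ·-recip (denominator i j k) (begin
  denominator i j k 0 0                       ≡⟨ ⊛-00 (qpoch 1 i ⊛ qpoch 2 j) (qpoch 3 k) ⟩
  (qpoch 1 i ⊛ qpoch 2 j) 0 0 ℤ.* qpoch 3 k 0 0
    ≡⟨ cong₂ ℤ._*_ (trans (⊛-00 (qpoch 1 i) (qpoch 2 j)) (cong₂ ℤ._*_ (qpoch-00 0 i) (qpoch-00 1 j))) (qpoch-00 2 k) ⟩
  1ℤ ∎)
  where open ≡-Reasoning

1/denominator-000 : 1/denominator 0 0 0 ≈ 𝟙
1/denominator-000 = begin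
  1/denominator 0 0 0                        ≈⟨ Ring.*-identityˡ _ ⟨
  𝟙 · 1/denominator 0 0 0                    ≈⟨ Ring.*-congʳ unit ⟨
  denominator 0 0 0 · 1/denominator 0 0 0    ≈⟨ denominator-·-1/denominator 0 0 0 ⟩
  𝟙                              ∎
  where
  open ≈-Reasoning
  unit : denominator 0 0 0 ≈ 𝟙
  unit = Ring.trans (denominator≈· 0 0 0) (Ring.trans (Ring.*-identityʳ _) (Ring.*-identityʳ _))

-- Multiply D′ + t D = D by e e′ and cancel. For Pochhammer symbols this is 1/(q;q)ₙ₊₁ = 1/(q;q)ₙ +
-- qⁿ⁺¹/(q;q)ₙ₊₁, the source of all contiguous relations below.
inverse-step : ∀ {D D′ e e′ t} → D′ +ˢ t · D ≈ D → D · e ≈ 𝟙 → D′ · e′ ≈ 𝟙 → e′ ≈ e +ˢ t · e′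
inverse-step {D} {D′} {e} {e′} {t} step De D′e′ = begin
  e′                                     ≈⟨ Ring.*-identityˡ e′ ⟨
  𝟙 · e′                                 ≈⟨ Ring.*-congʳ (Ring.trans (Ring.*-congʳ step) De) ⟨
  (D′ +ˢ t · D) · e · e′
    ≈⟨ solve 5 (λ D D′ e e′ t → (D′ :+ t :* D) :* e :* e′ := (D′ :* e′) :* e :+ t :* ((D :* e) :* e′)) Ring.refl D D′ e e′ t ⟩
  (D′ · e′) · e +ˢ t · ((D · e) · e′)
    ≈⟨ Ring.+-cong (Ring.trans (Ring.*-congʳ D′e′) (Ring.*-identityˡ e))
                   (Ring.*-congˡ (Ring.trans (Ring.*-congʳ De) (Ring.*-identityˡ e′))) ⟩
  e +ˢ t · e′                            ∎
  where open ≈-Reasoning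

factor-step : ∀ {D D′ p p′ z t} → D ≈ p · z → D′ ≈ p′ · z → p′ +ˢ t · p ≈ p → D′ +ˢ t · D ≈ D
factor-step {D} {D′} {p} {p′} {z} {t} D≈ D′≈ step = begin
  D′ +ˢ t · D              ≈⟨ Ring.+-cong D′≈ (Ring.*-congˡ D≈) ⟩
  p′ · z +ˢ t · (p · z)    ≈⟨ solve 4 (λ p p′ z t → p′ :* z :+ t :* (p :* z) := (p′ :+ t :* p) :* z) Ring.refl p p′ z t ⟩
  (p′ +ˢ t · p) · z        ≈⟨ Ring.*-congʳ step ⟩
  p · z                    ≈⟨ D≈ ⟨
  D                        ∎
  where open ≈-Reasoning

1/denominator-suc₁ : ∀ i j k → 1/denominator (suc i) j k ≈ 1/denominator i j k +ˢ (x^ 0 q^ (suc i * 1)) · 1/denominator (suc i) j k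
1/denominator-suc₁ i j k = inverse-step (factor-step (factor i) (factor (suc i)) (qpoch-suc 1 i))
  (denominator-·-1/denominator i j k) (denominator-·-1/denominator (suc i) j k)
  where
  factor : ∀ i → denominator i j k ≈ qpoch 1 i · (qpoch 2 j · qpoch 3 k)
  factor i = Ring.trans (denominator≈· i j k) (Ring.*-assoc _ _ _)

1/denominator-suc₂ : ∀ i j k → 1/denominator i (suc j) k ≈ 1/denominator i j k +ˢ (x^ 0 q^ (suc j * 2)) · 1/denominator i (suc j) k
1/denominator-suc₂ i j k = inverse-step (factor-step (factor j) (factor (suc j)) (qpoch-suc 2 j))
  (denominator-·-1/denominator i j k) (denominator-·-1/denominator i (suc j) k)
  where
  factor : ∀ j → denominator i j k ≈ qpoch 2 j · (qpoch 1 i · qpoch 3 k)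
  factor j = Ring.trans (denominator≈· i j k)
    (solve 3 (λ a b c → a :* b :* c := b :* (a :* c)) Ring.refl (qpoch 1 i) (qpoch 2 j) (qpoch 3 k))

1/denominator-suc₃ : ∀ i j k → 1/denominator i j (suc k) ≈ 1/denominator i j k +ˢ (x^ 0 q^ (suc k * 3)) · 1/denominator i j (suc k)
1/denominator-suc₃ i j k = inverse-step (factor-step (factor k) (factor (suc k)) (qpoch-suc 3 k))
  (denominator-·-1/denominator i j k) (denominator-·-1/denominator i j (suc k))
  where
  factor : ∀ k → denominator i j k ≈ qpoch 3 k · (qpoch 1 i · qpoch 2 j)
  factor k = Ring.trans (denominator≈· i j k) (Ring.*-comm _ _)

-- The triple series

-- The binomial coefficient n(n-1)/2 in recursive form, so that replacing N by N + 1, N + 2 or N + 3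
-- unfolds by computation instead of by division.
tri : ℕ → ℕ
tri zero    = 0
tri (suc n) = n + tri n

tri-closed : ∀ n → (n * (n ∸ 1)) / 2 ≡ tri n
tri-closed n = trans (cong (_/ 2) (double n)) (m*n/n≡m (tri n) 2)
  where
  step : ∀ n t → n * (n ∸ 1) ≡ t * 2 → suc n * n ≡ (n + t) * 2
  step zero    t p = p
  step (suc n) t p = trans (lemma n) (trans (cong (_+ suc n * 2) p) (lemma′ n t))
    where
    lemma : ∀ n → suc (suc n) * suc n ≡ suc n * n + suc n * 2
    lemma = solve-∀
    lemma′ : ∀ n t → t * 2 + suc n * 2 ≡ (suc n + t) * 2
    lemma′ = solve-∀

  double : ∀ n → n * (n ∸ 1) ≡ tri n * 2
  double zero    = refl
  double (suc n) = step n (tri n) (double n)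

weight : ℕ → ℕ → ℕ → ℕ
weight i j k = i + 2 * j + 3 * k

exponent : (a b c i j k : ℕ) → ℕ
exponent a b c i j k = tri (weight i j k) + (a * i + (b * j + j * j) + c * k)

term : (a b c i j k : ℕ) → Series
term a b c i j k = (x^ weight i j k q^ exponent a b c i j k) · 1/denominator i j k

∑k-term : (a b c i j : ℕ) → Series
∑k-term a b c i j = ∑ (term a b c i j)

∑jk-term : (a b c i : ℕ) → Series
∑jk-term a b c i = ∑ (∑k-term a b c i)

tripleSum : (a b c : ℕ) → Series
tripleSum a b c = ∑ (∑jk-term a b c)

i≤weight : ∀ i j k → i ≤ weight i j k
i≤weight i j k = ℕ.≤-trans (ℕ.m≤m+n i (2 * j)) (ℕ.m≤m+n _ (3 * k))

j≤weight : ∀ i j k → j ≤ weight i j k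
j≤weight i j k = ℕ.≤-trans (ℕ.m≤m+n j _) (ℕ.≤-trans (ℕ.m≤n+m (2 * j) i) (ℕ.m≤m+n _ (3 * k)))

k≤weight : ∀ i j k → k ≤ weight i j k
k≤weight i j k = ℕ.≤-trans (ℕ.m≤m+n k _) (ℕ.m≤n+m (3 * k) (i + 2 * j))

term-XOrder : ∀ a b c i j k → XOrder (weight i j k) (term a b c i j k)
term-XOrder a b c i j k = XOrder-x^q^-· _ _ (1/denominator i j k)

term-XOrder-k : ∀ a b c i j k → XOrder k (term a b c i j k)
term-XOrder-k a b c i j k = XOrder-≤ (k≤weight i j k) (term-XOrder a b c i j k)

∑k-XOrder-j : ∀ a b c i j → XOrder j (∑k-term a b c i j)
∑k-XOrder-j a b c i j = ∑-XOrder (term a b c i j) λ k →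
  XOrder-≤ (j≤weight i j k) (term-XOrder a b c i j k)

∑jk-XOrder-i : ∀ a b c i → XOrder i (∑jk-term a b c i)
∑jk-XOrder-i a b c i = ∑-XOrder (∑k-term a b c i) λ j → ∑-XOrder (term a b c i j) λ k →
  XOrder-≤ (i≤weight i j k) (term-XOrder a b c i j k)

x^q^-cong : ∀ {α α′ β β′} → α ≡ α′ → β ≡ β′ → x^ α q^ β ≈ x^ α′ q^ β′
x^q^-cong refl refl = Ring.refl

-- The common shape of the three contiguous relations. In the part with e′ the factor q^p is
-- absorbed into the exponent, which raises a, b or c; in the part with e the index has dropped by
-- one, and x^α q^β is what is left over.
monomial-step : ∀ {e e′} α β {A A′ B B′ B″ p} → e′ ≈ e +ˢ (x^ 0 q^ p) · e′ →
                A ≡ α + A′ → B ≡ β + B′ → B″ ≡ B + p →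
                (x^ A q^ B) · e′ ≈ (x^ A q^ B″) · e′ +ˢ (x^ α q^ β) · ((x^ A′ q^ B′) · e)
monomial-step {e} {e′} α β {A′ = A′} {B′ = B′} {p = p} step refl refl refl = begin
  m · e′                            ≈⟨ Ring.*-congˡ step ⟩
  m · (e +ˢ (x^ 0 q^ p) · e′)       ≈⟨ Ring.trans (Ring.distribˡ _ _ _) (Ring.+-comm _ _) ⟩
  m · ((x^ 0 q^ p) · e′) +ˢ m · e
    ≈⟨ Ring.+-cong (Ring.trans (Ring.sym (Ring.*-assoc _ _ _)) (Ring.*-congʳ (x^q^-· (α + A′) (β + B′) 0 p)))
                   (Ring.trans (Ring.*-congʳ (Ring.sym (x^q^-· α β A′ B′))) (Ring.*-assoc _ _ _)) ⟩
  (x^ (α + A′ + 0) q^ (β + B′ + p)) · e′ +ˢ (x^ α q^ β) · ((x^ A′ q^ B′) · e)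
    ≈⟨ Ring.+-congʳ (Ring.*-congʳ (x^q^-cong (ℕ.+-identityʳ (α + A′)) refl)) ⟩
  (x^ (α + A′) q^ (β + B′ + p)) · e′ +ˢ (x^ α q^ β) · ((x^ A′ q^ B′) · e) ∎
  where
  open ≈-Reasoning
  m : Series
  m = x^ (α + A′) q^ (β + B′)

-- Raising i by one raises N by one and the triangular exponent by N = i + 2j + 3k. This adds (1, 2,
-- 3) to (a, b, c), and q^a remains from a(i + 1).
term-suc₁ : ∀ a b c i j k →
  term a b c (suc i) j k ≈ term (suc a) b c (suc i) j k +ˢ (x^ 1 q^ a) · term (1 + a) (2 + b) (3 + c) i j k
term-suc₁ a b c i j k = monomial-step 1 a (1/denominator-suc₁ i j k) refl
  (shift a b c i j k (tri (weight i j k))) (bump a b c i j k (tri (weight (suc i) j k)))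
  where
  shift : ∀ a b c i j k t → ((i + 2 * j + 3 * k) + t) + (a * (1 + i) + (b * j + j * j) + c * k)
        ≡ a + (t + ((1 + a) * i + ((2 + b) * j + j * j) + (3 + c) * k))
  shift = solve-∀
  bump : ∀ a b c i j k t → t + ((1 + a) * (1 + i) + (b * j + j * j) + c * k)
       ≡ t + (a * (1 + i) + (b * j + j * j) + c * k) + (1 + i) * 1
  bump = solve-∀

-- Now the triangular exponent grows by 2N + 1 and j² by 2j + 1. Together they add (2, 6, 6) to (a,
-- b, c) and leave q^(2+b).
term-suc₂ : ∀ a b c i j k →
  term a b c i (suc j) k ≈ term a (2 + b) c i (suc j) k +ˢ (x^ 2 q^ (2 + b)) · term (2 + a) (6 + b) (6 + c) i j k
term-suc₂ a b c i j k = monomial-step 2 (2 + b) (1/denominator-suc₂ i j k) (weight-suc i j k)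
  (trans (cong (_+ rest) (cong tri (weight-suc i j k))) (shift a b c i j k (tri (weight i j k))))
  (bump a b c i j k (tri (weight i (suc j) k)))
  where
  rest : ℕ
  rest = a * i + (b * suc j + suc j * suc j) + c * k
  weight-suc : ∀ i j k → i + 2 * (1 + j) + 3 * k ≡ 2 + (i + 2 * j + 3 * k)
  weight-suc = solve-∀
  shift : ∀ a b c i j k t →
    (1 + (i + 2 * j + 3 * k)) + ((i + 2 * j + 3 * k) + t) + (a * i + (b * (1 + j) + (1 + j) * (1 + j)) + c * k)
    ≡ 2 + b + (t + ((2 + a) * i + ((6 + b) * j + j * j) + (6 + c) * k))
  shift = solve-∀
  bump : ∀ a b c i j k t → t + (a * i + ((2 + b) * (1 + j) + (1 + j) * (1 + j)) + c * k)
       ≡ t + (a * i + (b * (1 + j) + (1 + j) * (1 + j)) + c * k) + (1 + j) * 2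
  bump = solve-∀

-- Here the triangular exponent grows by 3N + 3, which adds (3, 6, 9) and leaves q^(3+c).
term-suc₃ : ∀ a b c i j k →
  term a b c i j (suc k) ≈ term a b (3 + c) i j (suc k) +ˢ (x^ 3 q^ (3 + c)) · term (3 + a) (6 + b) (9 + c) i j k
term-suc₃ a b c i j k = monomial-step 3 (3 + c) (1/denominator-suc₃ i j k) (weight-suc i j k)
  (trans (cong (_+ rest) (cong tri (weight-suc i j k))) (shift a b c i j k (tri (weight i j k))))
  (bump a b c i j k (tri (weight i j (suc k))))
  where
  rest : ℕ
  rest = a * i + (b * j + j * j) + c * suc k
  weight-suc : ∀ i j k → i + 2 * j + 3 * (1 + k) ≡ 3 + (i + 2 * j + 3 * k)
  weight-suc = solve-∀
  shift : ∀ a b c i j k t →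
    (2 + (i + 2 * j + 3 * k)) + ((1 + (i + 2 * j + 3 * k)) + ((i + 2 * j + 3 * k) + t)) + (a * i + (b * j + j * j) + c * (1 + k))
    ≡ 3 + c + (t + ((3 + a) * i + ((6 + b) * j + j * j) + (9 + c) * k))
  shift = solve-∀
  bump : ∀ a b c i j k t → t + (a * i + (b * j + j * j) + (3 + c) * (1 + k))
       ≡ t + (a * i + (b * j + j * j) + c * (1 + k)) + (1 + k) * 3
  bump = solve-∀

term-cong : ∀ {a b c a′ b′ c′} i j k → exponent a b c i j k ≡ exponent a′ b′ c′ i j k →
            term a b c i j k ≈ term a′ b′ c′ i j k
term-cong i j k p = Ring.*-congʳ (x^q^-cong {weight i j k} refl p)

-- The summation over the raised index uses `∑-shift`, the other two use `∑-linear`. At i = 0 the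
-- parameter a has no effect, so the two sides start with the same term.
tripleSum-step₁ : ∀ a b c → tripleSum a b c ≈ tripleSum (1 + a) b c +ˢ (x^ 1 q^ a) · tripleSum (1 + a) (2 + b) (3 + c)
tripleSum-step₁ a b c = ∑-shift {∑jk-term a b c} {∑jk-term (1 + a) b c} {∑jk-term (1 + a) (2 + b) (3 + c)}
  (∑-cong {∑k-term a b c 0} {∑k-term (1 + a) b c 0} λ j →
    ∑-cong {term a b c 0 j} {term (1 + a) b c 0 j} λ k → term-cong {a} {b} {c} {1 + a} {b} {c} 0 j k (base a b c j k (tri (weight 0 j k))))
  (λ i → ∑-linear {∑k-term a b c (suc i)} {∑k-term (1 + a) b c (suc i)} {∑k-term (1 + a) (2 + b) (3 + c) i}
    (λ j → ∑-linear {term a b c (suc i) j} {term (1 + a) b c (suc i) j} {term (1 + a) (2 + b) (3 + c) i j}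
      (term-suc₁ a b c i j)
      (term-XOrder-k (1 + a) (2 + b) (3 + c) i j))
    (∑k-XOrder-j (1 + a) (2 + b) (3 + c) i))
  (∑jk-XOrder-i a b c) (∑jk-XOrder-i (1 + a) b c) (∑jk-XOrder-i (1 + a) (2 + b) (3 + c))
  where
  base : ∀ a b c j k t → t + (a * 0 + (b * j + j * j) + c * k) ≡ t + ((1 + a) * 0 + (b * j + j * j) + c * k)
  base = solve-∀

tripleSum-step₂ : ∀ a b c → tripleSum a b c ≈ tripleSum a (2 + b) c +ˢ (x^ 2 q^ (2 + b)) · tripleSum (2 + a) (6 + b) (6 + c)
tripleSum-step₂ a b c = ∑-linear {∑jk-term a b c} {∑jk-term a (2 + b) c} {∑jk-term (2 + a) (6 + b) (6 + c)}
  (λ i → ∑-shift {∑k-term a b c i} {∑k-term a (2 + b) c i} {∑k-term (2 + a) (6 + b) (6 + c) i}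
    (∑-cong {term a b c i 0} {term a (2 + b) c i 0} λ k → term-cong {a} {b} {c} {a} {2 + b} {c} i 0 k (base a b c i k (tri (weight i 0 k))))
    (λ j → ∑-linear {term a b c i (suc j)} {term a (2 + b) c i (suc j)} {term (2 + a) (6 + b) (6 + c) i j}
      (term-suc₂ a b c i j)
      (term-XOrder-k (2 + a) (6 + b) (6 + c) i j))
    (∑k-XOrder-j a b c i) (∑k-XOrder-j a (2 + b) c i) (∑k-XOrder-j (2 + a) (6 + b) (6 + c) i))
  (∑jk-XOrder-i (2 + a) (6 + b) (6 + c))
  where
  base : ∀ a b c i k t → t + (a * i + (b * 0 + 0) + c * k) ≡ t + (a * i + ((2 + b) * 0 + 0) + c * k)
  base = solve-∀

tripleSum-step₃ : ∀ a b c → tripleSum a b c ≈ tripleSum a b (3 + c) +ˢ (x^ 3 q^ (3 + c)) · tripleSum (3 + a) (6 + b) (9 + c)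
tripleSum-step₃ a b c = ∑-linear {∑jk-term a b c} {∑jk-term a b (3 + c)} {∑jk-term (3 + a) (6 + b) (9 + c)}
  (λ i → ∑-linear {∑k-term a b c i} {∑k-term a b (3 + c) i} {∑k-term (3 + a) (6 + b) (9 + c) i}
    (λ j → ∑-shift {term a b c i j} {term a b (3 + c) i j} {term (3 + a) (6 + b) (9 + c) i j}
      (term-cong {a} {b} {c} {a} {b} {3 + c} i j 0 (base a b c i j (tri (weight i j 0))))
      (term-suc₃ a b c i j)
      (term-XOrder-k a b c i j) (term-XOrder-k a b (3 + c) i j) (term-XOrder-k (3 + a) (6 + b) (9 + c) i j))
    (∑k-XOrder-j (3 + a) (6 + b) (9 + c) i))
  (∑jk-XOrder-i (3 + a) (6 + b) (9 + c))
  where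
  base : ∀ a b c i j t → t + (a * i + (b * j + j * j) + c * 0) ≡ t + (a * i + (b * j + j * j) + (3 + c) * 0)
  base = solve-∀

tripleSum-cong : ∀ {a b c a′ b′ c′} → a ≡ a′ → b ≡ b′ → c ≡ c′ → tripleSum a b c ≈ tripleSum a′ b′ c′
tripleSum-cong refl refl refl = Ring.refl

-- Congruence to 1 modulo q^v, the initial condition of the induction that counts partitions.
Matches𝟙Below : ℕ → Series → Set
Matches𝟙Below v f = ∀ a n → n < v → f a n ≡ 𝟙 a n

∑-matches𝟙Below : ∀ {v} h → Matches𝟙Below v (h 0) → (∀ i a n → n < v → h (suc i) a n ≡ 0ℤ) → Matches𝟙Below v (∑ h)
∑-matches𝟙Below h h₀ hₛ a n n<v =
  trans (cong₂ ℤ._+_ (h₀ a n n<v) (sum-zero a λ i _ → hₛ i a n n<v)) (ℤ.+-identityʳ _)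

term-000 : ∀ a b c → term a b c 0 0 0 ≈ 𝟙
term-000 a b c = begin
  (x^ 0 q^ exponent a b c 0 0 0) · 1/denominator 0 0 0 ≈⟨ Ring.*-cong (x^q^-cong {0} refl (exponent-000 a b c)) 1/denominator-000 ⟩
  𝟙 · 𝟙                                    ≈⟨ Ring.*-identityˡ 𝟙 ⟩
  𝟙                                        ∎
  where
  open ≈-Reasoning
  exponent-000 : ∀ a b c → a * 0 + (b * 0 + 0) + c * 0 ≡ 0
  exponent-000 = solve-∀

term-high : ∀ {v} a b c i j k → v ≤ a * i + (b * j + j * j) + c * k →
            ∀ m n → n < v → term a b c i j k m n ≡ 0ℤ
term-high a b c i j k v≤e m n n<v = x^q^-·-zero (weight i j k) (exponent a b c i j k) (1/denominator i j k) {m}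
  (inj₂ (ℕ.<-≤-trans n<v (ℕ.≤-trans v≤e (ℕ.m≤n+m _ (tri (weight i j k))))))

tripleSum-matches𝟙Below : ∀ {v a b c} → v ≤ a → v ≤ b → v ≤ c → Matches𝟙Below v (tripleSum a b c)
tripleSum-matches𝟙Below {v} {a} {b} {c} v≤a v≤b v≤c =
  ∑-matches𝟙Below (∑jk-term a b c)
    (∑-matches𝟙Below (∑k-term a b c 0)
      (∑-matches𝟙Below (term a b c 0 0) (λ m n _ → at (term-000 a b c) m n)
        (λ k → term-high a b c 0 0 (suc k) (k-large k)))
      (λ j m n n<v → sum-zero (suc m) λ k _ → term-high a b c 0 (suc j) k (j-large j k) m n n<v))
    (λ i m n n<v → sum-zero (suc m) λ j _ → sum-zero (suc m) λ k _ →
      term-high a b c (suc i) j k (i-large i j k) m n n<v)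
  where
  open ℕ.≤-Reasoning

  i-large : ∀ i j k → v ≤ a * suc i + (b * j + j * j) + c * k
  i-large i j k = begin
    v                                   ≤⟨ ℕ.≤-trans (ℕ.m≤m*n v (suc i)) (ℕ.*-monoˡ-≤ (suc i) v≤a) ⟩
    a * suc i                           ≤⟨ ℕ.m≤m+n _ (b * j + j * j) ⟩
    a * suc i + (b * j + j * j)         ≤⟨ ℕ.m≤m+n _ (c * k) ⟩
    a * suc i + (b * j + j * j) + c * k ∎

  j-large : ∀ j k → v ≤ a * 0 + (b * suc j + suc j * suc j) + c * k
  j-large j k = begin
    v                                               ≤⟨ ℕ.≤-trans (ℕ.m≤m*n v (suc j)) (ℕ.*-monoˡ-≤ (suc j) v≤b) ⟩
    b * suc j                                       ≤⟨ ℕ.m≤m+n _ (suc j * suc j) ⟩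
    b * suc j + suc j * suc j                       ≤⟨ ℕ.m≤n+m _ (a * 0) ⟩
    a * 0 + (b * suc j + suc j * suc j)             ≤⟨ ℕ.m≤m+n _ (c * k) ⟩
    a * 0 + (b * suc j + suc j * suc j) + c * k     ∎

  k-large : ∀ k → v ≤ a * 0 + (b * 0 + 0) + c * suc k
  k-large k = begin
    v                                   ≤⟨ ℕ.≤-trans (ℕ.m≤m*n v (suc k)) (ℕ.*-monoˡ-≤ (suc k) v≤c) ⟩
    c * suc k                           ≤⟨ ℕ.m≤n+m _ (a * 0 + (b * 0 + 0)) ⟩
    a * 0 + (b * 0 + 0) + c * suc k     ∎

-- Partitions and their states

-- Bounds on parts past the end of π are vacuous, so a condition on the next few parts can be stated
-- without knowing how many there are.
BoundedBelow : List ℕ → List ℕ → Set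
BoundedBelow []       π       = ⊤
BoundedBelow (b ∷ bs) []      = ⊤
BoundedBelow (b ∷ bs) (x ∷ π) = b ≤ x × BoundedBelow bs π

-- For x ≤ y ≤ z with z ≤ 1 + x, the sum x + y + z is 2 mod 3 only if y = z = 1 + x.
Triple : ℕ → List ℕ → Set
Triple x (y ∷ z ∷ _) = 2 + x ≤ z ⊎ y ≡ 1 + x × z ≡ 1 + x
Triple x _           = ⊤

-- Condition(2) together with weak increase, in local form: each part constrains only the three
-- parts that follow it.
Good : List ℕ → Set
Good []      = ⊤
Good (x ∷ π) = BoundedBelow (x ∷ x ∷ 3 + x ∷ []) π × Triple x π × Good π

-- The parts equal to v - 2 and v - 1 restrict the parts ≥ v that may follow only
-- through lower bounds on the first few of the latter.  The names describe parts
-- v - 2 and v - 1: once is v - 2 twice and no v - 1 (so v occurs at most once),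
-- single is v - 1 once and no v - 2, pair is one of each, double is v - 1 twice.
-- No partition is in state dead, the target of forbidden transitions.
data State : Set where
  free once single pair double dead : State

bounds : State → ℕ → List ℕ
bounds free   v = v ∷ []
bounds once   v = v ∷ 1 + v ∷ []
bounds single v = v ∷ v ∷ 2 + v ∷ []
bounds pair   v = v ∷ 1 + v ∷ 2 + v ∷ []
bounds double v = 1 + v ∷ 2 + v ∷ []
bounds dead   v = []

Ok : State → ℕ → List ℕ → Set
Ok dead v π = ⊥
Ok t    v π = Good π × BoundedBelow (bounds t v) π

-- Constraints from parts older than two values have become automatic. For instance, after v - 1, v,
-- v the old part v - 1 asks for a next part of at least v + 2, which `double` already imposes. In
-- state `pair` the part v - 2 allows only one part below v + 1, so a second copy of v leads to
-- `dead`.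
next₀ next₁ next₂ : State → State
next₀ double = once
next₀ dead   = dead
next₀ _      = free

next₁ free   = single
next₁ once   = single
next₁ single = pair
next₁ pair   = pair
next₁ double = dead
next₁ dead   = dead

next₂ free   = double
next₂ single = double
next₂ _      = dead

-- At most two copies of v occur, because three equal parts have a sum divisible by 3.
data Split (t : State) (v : ℕ) : List ℕ → Set where
  none : ∀ {π} → Ok (next₀ t) (1 + v) π → Split t v π
  one  : ∀ {π} → Ok (next₁ t) (1 + v) π → Split t v (v ∷ π)
  two  : ∀ {π} → Ok (next₂ t) (1 + v) π → Split t v (v ∷ v ∷ π)

after-one : ∀ {v y π} → Good (v ∷ y ∷ π) → v < y →
            Good (y ∷ π) × BoundedBelow (1 + v ∷ 1 + v ∷ 3 + v ∷ []) (y ∷ π)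
after-one {π = []}        (_ , _ , g) v<y = g , v<y , tt
after-one {π = z ∷ []}    (_ , _ , g@((y≤z , _) , _)) v<y = g , v<y , ℕ.≤-trans v<y y≤z , tt
after-one {π = z ∷ w ∷ π} ((_ , _ , v+3≤w , _) , _ , g@((y≤z , _) , _)) v<y = g , v<y , ℕ.≤-trans v<y y≤z , v+3≤w , tt

-- In the triple v, v, z the middle part is not v + 1, so only the alternative z ≥ v + 2 survives.
after-two : ∀ {v π} → Good (v ∷ v ∷ π) → Ok double (1 + v) π
after-two {π = []} _ = tt , tt
after-two {v} {z ∷ []}    (_ , inj₁ v+2≤z , (_ , _ , g)) = g , v+2≤z , tt
after-two {v} {z ∷ w ∷ π} ((_ , _ , v+3≤w , _) , inj₁ v+2≤z , (_ , _ , g)) = g , v+2≤z , v+3≤w , tt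
after-two {v} {z ∷ π}     (_ , inj₂ (v≡1+v , _) , _) = ⊥-elim (ℕ.1+n≢n (sym v≡1+v))

raise-second : ∀ {v π} → BoundedBelow (1 + v ∷ 1 + v ∷ 3 + v ∷ []) π → BoundedBelow (v ∷ 2 + v ∷ []) π →
               BoundedBelow (1 + v ∷ 2 + v ∷ 3 + v ∷ []) π
raise-second {π = []}        _ _ = tt
raise-second {π = y ∷ []}    (p , _) _ = p , tt
raise-second {π = y ∷ z ∷ π} (p , _ , r) (_ , s , _) = p , s , r

split : ∀ t {v π} → Ok t v π → Split t v π
split free {v} {[]} o = none o
split free {v} {x ∷ π} (g , v≤x , _) with ℕ.m≤n⇒m<n∨m≡n v≤x
... | inj₁ v<x = none (g , v<x , tt)
split free {v} {v ∷ []} _ | inj₂ refl = one (tt , tt)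
split free {v} {v ∷ y ∷ π} (g@((v≤y , _) , _) , _) | inj₂ refl with ℕ.m≤n⇒m<n∨m≡n v≤y
... | inj₁ v<y  = one (after-one g v<y)
... | inj₂ refl = two (after-two g)
split once {v} {[]} o = none o
split once {v} {x ∷ π} (g , v≤x , _) with ℕ.m≤n⇒m<n∨m≡n v≤x
... | inj₁ v<x = none (g , v<x , tt)
split once {v} {v ∷ []} _ | inj₂ refl = one (tt , tt)
split once {v} {v ∷ y ∷ π} (g , _ , v<y , _) | inj₂ refl = one (after-one g v<y)
split single {v} {[]} o = none (tt , tt)
split single {v} {x ∷ π} (g , v≤x , _) with ℕ.m≤n⇒m<n∨m≡n v≤x
... | inj₁ v<x = none (g , v<x , tt)
split single {v} {v ∷ []} _ | inj₂ refl = one (tt , tt)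
split single {v} {v ∷ y ∷ π} (g@((v≤y , _) , _) , _ , b) | inj₂ refl with ℕ.m≤n⇒m<n∨m≡n v≤y
... | inj₁ v<y  = let g′ , b′ = after-one g v<y in one (g′ , raise-second b′ b)
... | inj₂ refl = two (after-two g)
split pair {v} {[]} o = none (tt , tt)
split pair {v} {x ∷ π} (g , v≤x , _) with ℕ.m≤n⇒m<n∨m≡n v≤x
... | inj₁ v<x = none (g , v<x , tt)
split pair {v} {v ∷ []} _ | inj₂ refl = one (tt , tt)
split pair {v} {v ∷ y ∷ π} (g , _ , v<y , b) | inj₂ refl =
  let g′ , b′ = after-one g v<y in one (g′ , raise-second b′ (ℕ.<⇒≤ v<y , b))
split double o = none o

-- The one critical case is z = v + 1: then y is squeezed to v + 1 as well, and the triple is the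
-- permitted one.
Good-∷ : ∀ {v π} → Good π → BoundedBelow (1 + v ∷ 1 + v ∷ 3 + v ∷ []) π → Good (v ∷ π)
Good-∷ {π = []}     _ _ = tt , tt , tt
Good-∷ {π = y ∷ []} g (v<y , _) = (ℕ.<⇒≤ v<y , tt) , tt , g
Good-∷ {v} {y ∷ z ∷ π} g@((y≤z , _) , _) (v<y , v<z , b) = (ℕ.<⇒≤ v<y , ℕ.<⇒≤ v<z , b) , triple , g
  where
  triple : Triple v (y ∷ z ∷ π)
  triple with ℕ.m≤n⇒m<n∨m≡n v<z
  ... | inj₁ v+1<z = inj₁ v+1<z
  ... | inj₂ refl  = inj₂ (ℕ.≤-antisym y≤z v<y , refl)

Good-∷∷ : ∀ {v π} → Ok double (1 + v) π → Good (v ∷ v ∷ π)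
Good-∷∷ {v} {[]} _ = (ℕ.≤-refl , tt) , tt , tt , tt , tt
Good-∷∷ {v} {z ∷ []} (g , v+2≤z , _) =
  (ℕ.≤-refl , v≤z , tt) , inj₁ v+2≤z , (v≤z , tt) , tt , g
  where v≤z = ℕ.m+n≤o⇒n≤o 2 v+2≤z
Good-∷∷ {v} {z ∷ w ∷ π} (g , v+2≤z , v+3≤w , _) =
  (ℕ.≤-refl , v≤z , v+3≤w , tt) , inj₁ v+2≤z ,
  (v≤z , ℕ.m+n≤o⇒n≤o 3 v+3≤w , third π g) , inj₁ (ℕ.<⇒≤ v+3≤w) , g
  where
  v≤z = ℕ.m+n≤o⇒n≤o 2 v+2≤z
  third : ∀ π → Good (z ∷ w ∷ π) → BoundedBelow (3 + v ∷ []) π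
  third []      _ = tt
  third (u ∷ π) (_ , _ , (w≤u , _) , _) = ℕ.≤-trans v+3≤w w≤u , tt

lower-first : ∀ {b bs π} → BoundedBelow (1 + b ∷ bs) π → BoundedBelow (b ∷ []) π
lower-first {π = []}    _       = tt
lower-first {π = _ ∷ _} (p , _) = ℕ.<⇒≤ p , tt

lower-single : ∀ {v π} → BoundedBelow (1 + v ∷ 2 + v ∷ 3 + v ∷ []) π → BoundedBelow (1 + v ∷ 1 + v ∷ 3 + v ∷ []) π
lower-single {π = []}        _           = tt
lower-single {π = _ ∷ []}    (p , _)     = p , tt
lower-single {π = _ ∷ _ ∷ _} (p , r , s) = p , ℕ.<⇒≤ r , s

-- This is why `single` and `pair` forget everything when v is skipped. Three equal parts are
-- impossible, so the third part exceeds the first one, which is at least v + 1.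
free-bounded : ∀ {v π} → Good π → BoundedBelow (1 + v ∷ []) π →
               BoundedBelow (v ∷ v ∷ 2 + v ∷ []) π × BoundedBelow (v ∷ 1 + v ∷ 2 + v ∷ []) π
free-bounded {π = []}     _ _ = tt , tt
free-bounded {π = x ∷ []} _ (p , _) = (ℕ.<⇒≤ p , tt) , (ℕ.<⇒≤ p , tt)
free-bounded {π = x ∷ y ∷ []} ((x≤y , _) , _) (p , _) =
  let q = ℕ.≤-trans p x≤y in (ℕ.<⇒≤ p , ℕ.<⇒≤ q , tt) , (ℕ.<⇒≤ p , q , tt)
free-bounded {v} {x ∷ y ∷ z ∷ π} ((x≤y , _) , triple , _) (p , _) =
  let q = ℕ.≤-trans p x≤y in (ℕ.<⇒≤ p , ℕ.<⇒≤ q , third triple , tt) , (ℕ.<⇒≤ p , q , third triple , tt)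
  where
  third : Triple x (y ∷ z ∷ π) → 2 + v ≤ z
  third (inj₁ x+2≤z)     = ℕ.≤-trans (s≤s p) (ℕ.<⇒≤ x+2≤z)
  third (inj₂ (_ , refl)) = s≤s p

join : ∀ t {v π} → Split t v π → Ok t v π
join free   (none (g , b)) = g , lower-first b
join free   (one (g , b))  = Good-∷ g b , ℕ.≤-refl , tt
join free   (two o)        = Good-∷∷ o , ℕ.≤-refl , tt
join once   {π = []} (none o) = o
join once   {π = x ∷ []} (none (g , p , _)) = g , ℕ.<⇒≤ p , tt
join once   {π = x ∷ y ∷ π} (none (g@((x≤y , _) , _) , p , _)) = g , ℕ.<⇒≤ p , ℕ.≤-trans p x≤y , tt
join once   {π = v ∷ []} (one o) = (tt , tt , tt) , ℕ.≤-refl , tt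
join once   {π = v ∷ y ∷ π} (one (g , b)) = Good-∷ g b , ℕ.≤-refl , proj₁ b , tt
join single (none (g , b)) = g , proj₁ (free-bounded g b)
join single {v} {π = v ∷ π} (one (g , b)) = Good-∷ g (lower-single b) , ℕ.≤-refl , tail π b
  where
  tail : ∀ π → BoundedBelow (1 + v ∷ 2 + v ∷ 3 + v ∷ []) π → BoundedBelow (v ∷ 2 + v ∷ []) π
  tail []          _           = tt
  tail (_ ∷ [])    (p , _)     = ℕ.<⇒≤ p , tt
  tail (_ ∷ _ ∷ _) (p , r , _) = ℕ.<⇒≤ p , r , tt
join single {v} {π = v ∷ v ∷ π} (two o@(_ , b)) = Good-∷∷ o , ℕ.≤-refl , ℕ.≤-refl , tail π b
  where
  tail : ∀ π → BoundedBelow (2 + v ∷ 3 + v ∷ []) π → BoundedBelow (2 + v ∷ []) π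
  tail []      _       = tt
  tail (_ ∷ _) (p , _) = p , tt
join pair (none (g , b)) = g , proj₂ (free-bounded g b)
join pair {v} {π = v ∷ π} (one (g , b)) = Good-∷ g (lower-single b) , ℕ.≤-refl , tail π b
  where
  tail : ∀ π → BoundedBelow (1 + v ∷ 2 + v ∷ 3 + v ∷ []) π → BoundedBelow (1 + v ∷ 2 + v ∷ []) π
  tail []          _           = tt
  tail (_ ∷ [])    (p , _)     = p , tt
  tail (_ ∷ _ ∷ _) (p , r , _) = p , r , tt
join double (none o) = o

Ok-[] : ∀ t v → t ≢ dead → Ok t v []
Ok-[] free   v _ = tt , tt
Ok-[] once   v _ = tt , tt
Ok-[] single v _ = tt , tt
Ok-[] pair   v _ = tt , tt
Ok-[] double v _ = tt , tt
Ok-[] dead   v t≢dead = t≢dead refl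

Ok-head : ∀ t {v x π} → Ok t v (x ∷ π) → v ≤ x
Ok-head free   (_ , p , _) = p
Ok-head once   (_ , p , _) = p
Ok-head single (_ , p , _) = p
Ok-head pair   (_ , p , _) = p
Ok-head double (_ , p , _) = ℕ.<⇒≤ p

-- Comparison with Condition

triple-sum : ∀ x {y z} → y ≡ 1 + x → z ≡ 1 + x → + 3 ∣ℤ + (x + y + z) ℤ.- + 2
triple-sum x refl refl = subst (λ s → + 3 ∣ℤ + s ℤ.- + 2) (lemma x) (m∣m*n x)
  where
  -- With the 2 in front, the integer subtraction of 2 computes and leaves 3 * x.
  lemma : ∀ x → 2 + 3 * x ≡ x + (1 + x) + (1 + x)
  lemma = solve-∀

3∤1 : ¬ 3 ∣ 1
3∤1 = >⇒∤ (s≤s (s≤s z≤n))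

3∤2 : ¬ 3 ∣ 2
3∤2 = >⇒∤ (s≤s (s≤s (s≤s z≤n)))

-- The sum is 3x if all three are equal and 3x + 1 if only z is larger; neither is 2 modulo 3.
triple-sum⁻¹ : ∀ {x y z} → x ≤ y → y ≤ z → z ≤ 1 + x → + 3 ∣ℤ + (x + y + z) ℤ.- + 2 → y ≡ 1 + x × z ≡ 1 + x
triple-sum⁻¹ {x} x≤y y≤z z≤1+x d with ℕ.m≤n⇒m<n∨m≡n x≤y
... | inj₁ x<y = ℕ.≤-antisym (ℕ.≤-trans y≤z z≤1+x) x<y , ℕ.≤-antisym z≤1+x (ℕ.≤-trans x<y y≤z)
... | inj₂ refl with ℕ.m≤n⇒m<n∨m≡n y≤z
...   | inj₂ refl = ⊥-elim (not x d)
  where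
  not : ∀ x → ¬ + 3 ∣ℤ + (x + x + x) ℤ.- + 2
  -- For x = 0 the difference is negative and divisibility concerns its absolute value, hence the
  -- separate case.
  not zero    d = 3∤2 d
  not (suc x) d = 3∤1 (∣m+n∣m⇒∣n (subst (λ s → + 3 ∣ℤ + s ℤ.- + 2) (lemma x) d) (m∣m*n x))
    where
    lemma : ∀ x → (1 + x) + (1 + x) + (1 + x) ≡ 2 + (3 * x + 1)
    lemma = solve-∀
...   | inj₁ x<z rewrite ℕ.≤-antisym z≤1+x x<z = ⊥-elim (not x d)
  where
  not : ∀ x → ¬ + 3 ∣ℤ + (x + x + (1 + x)) ℤ.- + 2
  not zero    d = 3∤1 d
  not (suc x) d = 3∤2 (∣m+n∣m⇒∣n (subst (λ s → + 3 ∣ℤ + s ℤ.- + 2) (lemma x) d) (m∣m*n x))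
    where
    lemma : ∀ x → (1 + x) + (1 + x) + (1 + (1 + x)) ≡ 2 + (3 * x + 2)
    lemma = solve-∀

Condition-tail : ∀ {x π} → Condition (+ 2) (x ∷ π) → Condition (+ 2) π
Condition-tail (far , close) =
  (λ s s₃ e → far (fsuc s) (fsuc s₃) (cong suc e)) ,
  (λ s s₁ s₂ e₁ e₂ → close (fsuc s) (fsuc s₁) (fsuc s₂) (cong suc e₁) (cong suc e₂))

Condition⇒Good : ∀ π → Linked _≤_ π → Condition (+ 2) π → Good π
Condition⇒Good [] _ _ = tt
Condition⇒Good (x ∷ []) _ _ = tt , tt , tt
Condition⇒Good (x ∷ y ∷ []) (x≤y ∷ _) _ = (x≤y , tt) , tt , tt , tt , tt
Condition⇒Good (x ∷ y ∷ z ∷ π) (x≤y ∷ l@(y≤z ∷ _)) c@(far , close) =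
  (x≤y , ℕ.≤-trans x≤y y≤z , fourth π far) , triple , Condition⇒Good (y ∷ z ∷ π) l (Condition-tail c)
  where
  fourth : ∀ π → (∀ s s₃ → toℕ s₃ ≡ toℕ s + 3 → 3 ≤ lookup (x ∷ y ∷ z ∷ π) s₃ ∸ lookup (x ∷ y ∷ z ∷ π) s) →
           BoundedBelow (3 + x ∷ []) π
  fourth []      _   = tt
  -- A nonzero truncated difference forces x < w, so the subtraction is genuine and can be undone.
  fourth (w ∷ π) far = ℕ.≤-trans (ℕ.+-monoˡ-≤ x d) (ℕ.≤-reflexive (ℕ.m∸n+n≡m (ℕ.<⇒≤ (ℕ.m∸n≢0⇒n<m {w} {x} w∸x≢0)))) , tt
    where
    d : 3 ≤ w ∸ x
    d = far fzero (fsuc (fsuc (fsuc fzero))) refl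
    w∸x≢0 : w ∸ x ≢ 0
    w∸x≢0 e with () ← subst (3 ≤_) e d

  triple : Triple x (y ∷ z ∷ π)
  triple with ℕ.<-≤-connex (1 + x) z
  ... | inj₁ x+1<z = inj₁ x+1<z
  ... | inj₂ z≤1+x = inj₂ (triple-sum⁻¹ x≤y y≤z z≤1+x
    (close fzero (fsuc fzero) (fsuc (fsuc fzero)) refl refl
      (ℕ.≤-trans (ℕ.∸-monoˡ-≤ x z≤1+x) (ℕ.≤-reflexive (ℕ.m+n∸n≡m 1 x)))))

Good⇒Linked : ∀ π → Good π → Linked _≤_ π
Good⇒Linked []          _ = []
Good⇒Linked (x ∷ [])    _ = [-]
Good⇒Linked (x ∷ y ∷ π) ((x≤y , _) , _ , g) = x≤y ∷ Good⇒Linked (y ∷ π) g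

Good⇒Condition : ∀ π → Good π → Condition (+ 2) π
Good⇒Condition π g = far π g , close π g
  where
  far : ∀ π → Good π → ∀ s s₃ → toℕ s₃ ≡ toℕ s + 3 → 3 ≤ lookup π s₃ ∸ lookup π s
  far (x ∷ y ∷ z ∷ w ∷ π) ((_ , _ , x+3≤w , _) , _) fzero (fsuc (fsuc (fsuc fzero))) e =
    ℕ.≤-trans (ℕ.≤-reflexive (sym (ℕ.m+n∸n≡m 3 x))) (ℕ.∸-monoˡ-≤ x x+3≤w)
  far (x ∷ π)         _ fzero    fzero                 ()
  far (x ∷ y ∷ π)     _ fzero    (fsuc fzero)          ()
  far (x ∷ y ∷ z ∷ π) _ fzero    (fsuc (fsuc fzero))   ()
  far (x ∷ π)         _ (fsuc s) fzero                 ()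
  far (x ∷ π) (_ , _ , g) (fsuc s) (fsuc s₃) e = far π g s s₃ (ℕ.suc-injective e)

  close : ∀ π → Good π → ∀ s s₁ s₂ → toℕ s₁ ≡ toℕ s + 1 → toℕ s₂ ≡ toℕ s + 2 →
          lookup π s₂ ∸ lookup π s ≤ 1 → + 3 ∣ℤ + (lookup π s + lookup π s₁ + lookup π s₂) ℤ.- + 2
  close (x ∷ y ∷ z ∷ π) (_ , inj₂ (y≡1+x , z≡1+x) , _) fzero (fsuc fzero) (fsuc (fsuc fzero)) _ _ _ =
    triple-sum x y≡1+x z≡1+x
  close (x ∷ y ∷ z ∷ π) (_ , inj₁ x+2≤z , _) fzero (fsuc fzero) (fsuc (fsuc fzero)) _ _ z∸x≤1
    with s≤s () ← ℕ.≤-trans (ℕ.≤-trans (ℕ.≤-reflexive (sym (ℕ.m+n∸n≡m 2 x))) (ℕ.∸-monoˡ-≤ x x+2≤z)) z∸x≤1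
  close (x ∷ π)     _ fzero    fzero        _            ()
  close (x ∷ π)     _ fzero    (fsuc _)     fzero        _ ()
  close (x ∷ y ∷ π) _ fzero    (fsuc _)     (fsuc fzero) _ ()
  close (x ∷ y ∷ z ∷ π) _ fzero (fsuc (fsuc _)) (fsuc (fsuc _)) ()
  close (x ∷ π)     _ (fsuc s) fzero        _            ()
  close (x ∷ π)     _ (fsuc s) (fsuc _)     fzero        _ ()
  close (x ∷ π) (_ , _ , g) (fsuc s) (fsuc s₁) (fsuc s₂) e₁ e₂ p =
    close π g s s₁ s₂ (ℕ.suc-injective e₁) (ℕ.suc-injective e₂) p

-- The initial state treats π as if it followed a single part 0. Its bounds are 1, 1, 3; in a
-- positive good partition the third part is below 3 only if the partition begins with 1 + 2 + 2.
𝒫⇒Ok : ∀ {π} → 𝒫 π → Ok single 1 π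
𝒫⇒Ok {π} ((positive , linked) , condition , no122) = g , bound π g positive no122
  where
  g : Good π
  g = Condition⇒Good π linked condition

  bound : ∀ π → Good π → All (0 <_) π → ¬ (1 ∷ 2 ∷ 2 ∷ []) isSubPartitionOf π → BoundedBelow (1 ∷ 1 ∷ 3 ∷ []) π
  bound []              _ _                _ = tt
  bound (x ∷ [])        _ (p ∷ _)          _ = p , tt
  bound (x ∷ y ∷ [])    _ (p ∷ r ∷ _)      _ = p , r , tt
  bound (x ∷ y ∷ z ∷ π) (_ , triple , _) (p ∷ r ∷ _) no122 = p , r , third p triple no122 , tt
    where
    third : ∀ {x y z} → 1 ≤ x → Triple x (y ∷ z ∷ π) → ¬ (1 ∷ 2 ∷ 2 ∷ []) isSubPartitionOf (x ∷ y ∷ z ∷ π) → 3 ≤ z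
    third p (inj₁ x+2≤z) _ = ℕ.≤-trans (s≤s (s≤s p)) x+2≤z
    third {suc zero}    p (inj₂ (refl , refl)) no122 = ⊥-elim (no122 (here (refl ∷ refl ∷ refl ∷ [])))
    third {suc (suc x)} p (inj₂ (refl , refl)) _     = s≤s (s≤s (s≤s z≤n))

Ok⇒𝒫 : ∀ {π} → Ok single 1 π → 𝒫 π
Ok⇒𝒫 {π} (g , b) = (positive π g b , Good⇒Linked π g) , Good⇒Condition π g , no122 π g b
  where
  positive : ∀ {bs} π → Good π → BoundedBelow (1 ∷ bs) π → All (0 <_) π
  positive []          _ _ = []
  positive (x ∷ [])    _ (p , _) = p ∷ []
  positive (x ∷ y ∷ π) ((x≤y , _) , _ , g) (p , _) = p ∷ positive {[]} (y ∷ π) g (ℕ.≤-trans p x≤y , tt)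

  -- A part before 1 + 2 + 2 would have to be at least 3 below the last 2, so the pattern can only
  -- stand at the very beginning.
  later : ∀ x π → Good (x ∷ π) → ¬ (1 ∷ 2 ∷ 2 ∷ []) isSubPartitionOf π
  later x _ ((_ , _ , x+3≤2 , _) , _) (here (refl ∷ refl ∷ refl ∷ _)) with s≤s (s≤s ()) ← x+3≤2
  later x (y ∷ π) (_ , _ , g) (there i) = later y π g i

  no122 : ∀ π → Good π → BoundedBelow (1 ∷ 1 ∷ 3 ∷ []) π → ¬ (1 ∷ 2 ∷ 2 ∷ []) isSubPartitionOf π
  no122 _ _ (_ , _ , 3≤2 , _) (here (refl ∷ refl ∷ refl ∷ _)) with s≤s (s≤s ()) ← 3≤2
  no122 (x ∷ π) g _ (there i) = later x π g i

-- Generating functions of the states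

q¹ : Series
q¹ = x^ 0 q^ 1

xq^ : ℕ → Series
xq^ v = x^ 1 q^ v

x^q^-^ : ∀ α β n → (x^ α q^ β) ^ˢ n ≈ x^ (n * α) q^ (n * β)
x^q^-^ α β zero    = Ring.refl
x^q^-^ α β (suc n) = Ring.trans (Ring.*-congˡ (x^q^-^ α β n)) (x^q^-· α β (n * α) (n * β))

-- Writing all monomials in y = x q^v and q removes the variable u from the exponents, so that the
-- ring solver sees only fixed powers.
x^q^-split : ∀ α β v e → e ≡ α * v + β → x^ α q^ e ≈ xq^ v ^ˢ α · q¹ ^ˢ β
x^q^-split α β v _ refl = begin
  x^ α q^ (α * v + β)                             ≈⟨ x^q^-cong (lemma α β) (lemma′ α β v) ⟩
  x^ (α * 1 + β * 0) q^ (α * v + β * 1)           ≈⟨ x^q^-· (α * 1) (α * v) (β * 0) (β * 1) ⟨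
  (x^ (α * 1) q^ (α * v)) · (x^ (β * 0) q^ (β * 1)) ≈⟨ Ring.*-cong (x^q^-^ 1 v α) (x^q^-^ 0 1 β) ⟨
  xq^ v ^ˢ α · q¹ ^ˢ β                            ∎
  where
  open ≈-Reasoning
  lemma : ∀ α β → α ≡ α * 1 + β * 0
  lemma = solve-∀
  lemma′ : ∀ α β v → α * v + β ≡ α * v + β * 1
  lemma′ = solve-∀

-- φ u is S(1,2,2) at x qᵘ.
φ : ℕ → Series
φ u = tripleSum (1 + u) (2 + 2 * u) (2 + 3 * u)

-- Lowering along the contiguous relations produces `C` and `H`, which are shifts of φ, and also `G`
-- and `K`, which are not. These two occur only in the combination G + y²q⁸K, which the second
-- relation read backwards turns into `L`; the first relation gives L = H - yq³M, and `M` is again a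
-- shift of φ.
φ-recurrence : ∀ u → let y = xq^ (1 + u) in
  φ u ≈ φ (1 + u) +ˢ y · φ (1 + u) +ˢ y ^ˢ 2 · q¹ ^ˢ 2 · φ (3 + u) +ˢ y ^ˢ 3 · q¹ ^ˢ 2 · φ (3 + u)
        +ˢ y ^ˢ 4 · q¹ ^ˢ 5 · (-ˢ φ (4 + u))
φ-recurrence u = begin
  φ u
    ≈⟨ tripleSum-step₁ (1 + u) (2 + 2 * u) (2 + 3 * u) ⟩
  tripleSum (2 + u) (2 + 2 * u) (2 + 3 * u) +ˢ y · C
    ≈⟨ Ring.+-congʳ (tripleSum-step₂ (2 + u) (2 + 2 * u) (2 + 3 * u)) ⟩
  tripleSum (2 + u) (4 + 2 * u) (2 + 3 * u) +ˢ (x^ 2 q^ (4 + 2 * u)) · tripleSum (4 + u) (8 + 2 * u) (8 + 3 * u) +ˢ y · C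
    ≈⟨ Ring.+-congʳ (Ring.+-cong
         (Ring.trans (tripleSum-step₃ (2 + u) (4 + 2 * u) (2 + 3 * u)) (Ring.+-congˡ (Ring.*-congʳ (x^q^-split 3 2 (1 + u) _ (e₁ u)))))
         (Ring.*-cong (x^q^-split 2 2 (1 + u) _ (e₂ u))
           (Ring.trans (tripleSum-step₃ (4 + u) (8 + 2 * u) (8 + 3 * u)) (Ring.+-congˡ (Ring.*-congʳ (x^q^-split 3 8 (1 + u) _ (e₃ u))))))) ⟩
  C +ˢ y ^ˢ 3 · q ^ˢ 2 · G +ˢ y ^ˢ 2 · q ^ˢ 2 · (H +ˢ y ^ˢ 3 · q ^ˢ 8 · K) +ˢ y · C
    ≈⟨ solve 6 (λ y q C G H K →
         C :+ y :^ 3 :* q :^ 2 :* G :+ y :^ 2 :* q :^ 2 :* (H :+ y :^ 3 :* q :^ 8 :* K) :+ y :* C :=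
         C :+ y :* C :+ y :^ 2 :* q :^ 2 :* H :+ y :^ 3 :* q :^ 2 :* (G :+ y :^ 2 :* q :^ 8 :* K))
         Ring.refl y q C G H K ⟩
  C +ˢ y · C +ˢ y ^ˢ 2 · q ^ˢ 2 · H +ˢ y ^ˢ 3 · q ^ˢ 2 · (G +ˢ y ^ˢ 2 · q ^ˢ 8 · K)
    ≈⟨ Ring.+-congˡ (Ring.*-congˡ (Ring.trans (Ring.sym L-step) L≈)) ⟩
  C +ˢ y · C +ˢ y ^ˢ 2 · q ^ˢ 2 · H +ˢ y ^ˢ 3 · q ^ˢ 2 · (H +ˢ y · q ^ˢ 3 · (-ˢ M))
    ≈⟨ solve 5 (λ y q C H M′ →
         C :+ y :* C :+ y :^ 2 :* q :^ 2 :* H :+ y :^ 3 :* q :^ 2 :* (H :+ y :* q :^ 3 :* M′) :=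
         C :+ y :* C :+ y :^ 2 :* q :^ 2 :* H :+ y :^ 3 :* q :^ 2 :* H :+ y :^ 4 :* q :^ 5 :* M′)
         Ring.refl y q C H (-ˢ M) ⟩
  C +ˢ y · C +ˢ y ^ˢ 2 · q ^ˢ 2 · H +ˢ y ^ˢ 3 · q ^ˢ 2 · H +ˢ y ^ˢ 4 · q ^ˢ 5 · (-ˢ M)
    ≈⟨ Ring.+-cong (Ring.+-cong (Ring.+-cong (Ring.+-cong C≈ (Ring.*-congˡ C≈)) (Ring.*-congˡ H≈)) (Ring.*-congˡ H≈))
         (Ring.*-congˡ (Ring.-‿cong M≈)) ⟩
  φ (1 + u) +ˢ y · φ (1 + u) +ˢ y ^ˢ 2 · q ^ˢ 2 · φ (3 + u) +ˢ y ^ˢ 3 · q ^ˢ 2 · φ (3 + u)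
    +ˢ y ^ˢ 4 · q ^ˢ 5 · (-ˢ φ (4 + u)) ∎
  where
  open ≈-Reasoning
  y q C G H K L M : Series
  y = xq^ (1 + u)
  q = q¹
  C = tripleSum (2 + u) (4 + 2 * u) (5 + 3 * u)
  G = tripleSum (5 + u) (10 + 2 * u) (11 + 3 * u)
  H = tripleSum (4 + u) (8 + 2 * u) (11 + 3 * u)
  K = tripleSum (7 + u) (14 + 2 * u) (17 + 3 * u)
  L = tripleSum (5 + u) (8 + 2 * u) (11 + 3 * u)
  M = tripleSum (5 + u) (10 + 2 * u) (14 + 3 * u)

  e₁ : ∀ u → 3 + (2 + 3 * u) ≡ 3 * (1 + u) + 2
  e₁ = solve-∀
  e₂ : ∀ u → 2 + (2 + 2 * u) ≡ 2 * (1 + u) + 2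
  e₂ = solve-∀
  e₃ : ∀ u → 3 + (8 + 3 * u) ≡ 3 * (1 + u) + 8
  e₃ = solve-∀
  e₄ : ∀ u → 4 + u ≡ 1 * (1 + u) + 3
  e₄ = solve-∀
  e₅ : ∀ u → 2 + (8 + 2 * u) ≡ 2 * (1 + u) + 8
  e₅ = solve-∀

  L-step : L ≈ G +ˢ y ^ˢ 2 · q ^ˢ 8 · K
  L-step = Ring.trans (tripleSum-step₂ (5 + u) (8 + 2 * u) (11 + 3 * u))
    (Ring.+-congˡ (Ring.*-congʳ (x^q^-split 2 8 (1 + u) _ (e₅ u))))

  H-step : H ≈ L +ˢ y · q ^ˢ 3 · M
  H-step = Ring.trans (tripleSum-step₁ (4 + u) (8 + 2 * u) (11 + 3 * u))
    (Ring.+-congˡ (Ring.*-congʳ (Ring.trans (x^q^-split 1 3 (1 + u) _ (e₄ u)) (Ring.*-congʳ (Ring.*-identityʳ y)))))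

  L≈ : L ≈ H +ˢ y · q ^ˢ 3 · (-ˢ M)
  L≈ = Ring.sym (begin
    H +ˢ w · (-ˢ M)               ≈⟨ Ring.+-congʳ H-step ⟩
    L +ˢ w · M +ˢ w · (-ˢ M)      ≈⟨ solve 4 (λ L w M M′ → L :+ w :* M :+ w :* M′ := L :+ w :* (M :+ M′)) Ring.refl L w M (-ˢ M) ⟩
    L +ˢ w · (M +ˢ -ˢ M)          ≈⟨ Ring.+-congˡ (Ring.trans (Ring.*-congˡ (Ring.-‿inverseʳ M)) (Ring.zeroʳ w)) ⟩
    L +ˢ 0ˢ                       ≈⟨ Ring.+-identityʳ L ⟩
    L                             ∎)
    where
    w : Series
    w = y · q ^ˢ 3

  C≈ : C ≈ φ (1 + u)
  C≈ = tripleSum-cong {2 + u} refl (b u) (c u)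
    where
    b : ∀ u → 4 + 2 * u ≡ 2 + 2 * (1 + u)
    b = solve-∀
    c : ∀ u → 5 + 3 * u ≡ 2 + 3 * (1 + u)
    c = solve-∀

  H≈ : H ≈ φ (3 + u)
  H≈ = tripleSum-cong {4 + u} refl (b u) (c u)
    where
    b : ∀ u → 8 + 2 * u ≡ 2 + 2 * (3 + u)
    b = solve-∀
    c : ∀ u → 11 + 3 * u ≡ 2 + 3 * (3 + u)
    c = solve-∀

  M≈ : M ≈ φ (4 + u)
  M≈ = tripleSum-cong {5 + u} refl (b u) (c u)
    where
    b : ∀ u → 10 + 2 * u ≡ 2 + 2 * (4 + u)
    b = solve-∀
    c : ∀ u → 14 + 3 * u ≡ 2 + 3 * (4 + u)
    c = solve-∀

-- With y = x q¹⁺ᵘ this counts the partitions π with Ok t (1 + u) π.  The argument y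
-- is kept apart so that the ring solver sees x q²⁺ᵘ as y · q¹.
stateSeries : State → Series → ℕ → Series
stateSeries free   y u = φ u +ˢ y ^ˢ 2 · φ (2 + u)
stateSeries once   y u = φ u
stateSeries single y u = φ u +ˢ y ^ˢ 2 · φ (2 + u) +ˢ y ^ˢ 3 · q¹ ^ˢ 2 · (-ˢ φ (3 + u))
stateSeries pair   y u = φ u +ˢ y ^ˢ 3 · q¹ ^ˢ 2 · (-ˢ φ (3 + u))
stateSeries double y u = φ (1 + u)
stateSeries dead   y u = 0ˢ

stateSeries-cong : ∀ t {y y′} u → y ≈ y′ → stateSeries t y u ≈ stateSeries t y′ u
stateSeries-cong free   u p = Ring.+-congˡ (Ring.*-congʳ (^ˢ-congˡ 2 p))
stateSeries-cong once   u p = Ring.refl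
stateSeries-cong single u p = Ring.+-cong (Ring.+-congˡ (Ring.*-congʳ (^ˢ-congˡ 2 p))) (Ring.*-congʳ (Ring.*-congʳ (^ˢ-congˡ 3 p)))
stateSeries-cong pair   u p = Ring.+-congˡ (Ring.*-congʳ (Ring.*-congʳ (^ˢ-congˡ 3 p)))
stateSeries-cong double u p = Ring.refl
stateSeries-cong dead   u p = Ring.refl

GF : State → ℕ → Series
GF t u = stateSeries t (xq^ (1 + u)) u

stateSeries-step : ∀ t u → let y = xq^ (1 + u); S = λ t → stateSeries t (y · q¹) (1 + u) in
  stateSeries t y u ≈ S (next₀ t) +ˢ y · S (next₁ t) +ˢ y · (y · S (next₂ t))
stateSeries-step free u = Ring.trans (Ring.+-congʳ (φ-recurrence u))
  (solve 6 (λ y q p₁ p₂ p₃ n₄ →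
    p₁ :+ y :* p₁ :+ y :^ 2 :* q :^ 2 :* p₃ :+ y :^ 3 :* q :^ 2 :* p₃ :+ y :^ 4 :* q :^ 5 :* n₄ :+ y :^ 2 :* p₂ :=
    (p₁ :+ (y :* q) :^ 2 :* p₃) :+ y :* (p₁ :+ (y :* q) :^ 2 :* p₃ :+ (y :* q) :^ 3 :* q :^ 2 :* n₄) :+ y :* (y :* p₂))
    Ring.refl (xq^ (1 + u)) q¹ (φ (1 + u)) (φ (2 + u)) (φ (3 + u)) (-ˢ φ (4 + u)))
stateSeries-step once u = Ring.trans (φ-recurrence u)
  (solve 5 (λ y q p₁ p₃ n₄ →
    p₁ :+ y :* p₁ :+ y :^ 2 :* q :^ 2 :* p₃ :+ y :^ 3 :* q :^ 2 :* p₃ :+ y :^ 4 :* q :^ 5 :* n₄ :=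
    (p₁ :+ (y :* q) :^ 2 :* p₃) :+ y :* (p₁ :+ (y :* q) :^ 2 :* p₃ :+ (y :* q) :^ 3 :* q :^ 2 :* n₄) :+ y :* (y :* con 0))
    Ring.refl (xq^ (1 + u)) q¹ (φ (1 + u)) (φ (3 + u)) (-ˢ φ (4 + u)))
stateSeries-step single u = Ring.trans (Ring.+-congʳ (Ring.+-congʳ (φ-recurrence u))) (Ring.trans
  (solve 7 (λ y q p₁ p₂ p₃ n₃ n₄ →
    p₁ :+ y :* p₁ :+ y :^ 2 :* q :^ 2 :* p₃ :+ y :^ 3 :* q :^ 2 :* p₃ :+ y :^ 4 :* q :^ 5 :* n₄
      :+ y :^ 2 :* p₂ :+ y :^ 3 :* q :^ 2 :* n₃ :=
    (p₁ :+ (y :* q) :^ 2 :* p₃) :+ y :* (p₁ :+ (y :* q) :^ 3 :* q :^ 2 :* n₄) :+ y :* (y :* p₂)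
      :+ y :^ 3 :* q :^ 2 :* (p₃ :+ n₃))
    -- To the solver φ (3 + u) and its negative are unrelated atoms p₃ and n₃; their sum is
    -- collected here and cancelled in the next line.
    Ring.refl (xq^ (1 + u)) q¹ (φ (1 + u)) (φ (2 + u)) (φ (3 + u)) (-ˢ φ (3 + u)) (-ˢ φ (4 + u)))
  (Ring.trans (Ring.+-congˡ (Ring.trans (Ring.*-congˡ (Ring.-‿inverseʳ (φ (3 + u)))) (Ring.zeroʳ _))) (Ring.+-identityʳ _)))
stateSeries-step pair u = Ring.trans (Ring.+-congʳ (φ-recurrence u)) (Ring.trans
  (solve 6 (λ y q p₁ p₃ n₃ n₄ →
    p₁ :+ y :* p₁ :+ y :^ 2 :* q :^ 2 :* p₃ :+ y :^ 3 :* q :^ 2 :* p₃ :+ y :^ 4 :* q :^ 5 :* n₄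
      :+ y :^ 3 :* q :^ 2 :* n₃ :=
    (p₁ :+ (y :* q) :^ 2 :* p₃) :+ y :* (p₁ :+ (y :* q) :^ 3 :* q :^ 2 :* n₄) :+ y :* (y :* con 0)
      :+ y :^ 3 :* q :^ 2 :* (p₃ :+ n₃))
    Ring.refl (xq^ (1 + u)) q¹ (φ (1 + u)) (φ (3 + u)) (-ˢ φ (3 + u)) (-ˢ φ (4 + u)))
  (Ring.trans (Ring.+-congˡ (Ring.trans (Ring.*-congˡ (Ring.-‿inverseʳ (φ (3 + u)))) (Ring.zeroʳ _))) (Ring.+-identityʳ _)))
stateSeries-step double u =
  solve 2 (λ y p → p := p :+ y :* con 0 :+ y :* (y :* con 0)) Ring.refl (xq^ (1 + u)) (φ (1 + u))
stateSeries-step dead u =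
  solve 1 (λ y → con 0 := con 0 :+ y :* con 0 :+ y :* (y :* con 0)) Ring.refl (xq^ (1 + u))

GF-step : ∀ t u → let y = xq^ (1 + u) in
  GF t u ≈ GF (next₀ t) (1 + u) +ˢ y · GF (next₁ t) (1 + u) +ˢ y · (y · GF (next₂ t) (1 + u))
GF-step t u = Ring.trans (stateSeries-step t u)
  (Ring.+-cong (Ring.+-cong (shift (next₀ t)) (Ring.*-congˡ (shift (next₁ t)))) (Ring.*-congˡ (Ring.*-congˡ (shift (next₂ t)))))
  where
  y·q≈ : xq^ (1 + u) · q¹ ≈ xq^ (2 + u)
  y·q≈ = Ring.trans (x^q^-· 1 (1 + u) 0 1) (x^q^-cong {1} refl (ℕ.+-comm (1 + u) 1))

  shift : ∀ t → stateSeries t (xq^ (1 + u) · q¹) (1 + u) ≈ GF t (1 + u)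
  shift t = stateSeries-cong t (1 + u) y·q≈

φ-matches𝟙Below : ∀ u → Matches𝟙Below (1 + u) (φ u)
φ-matches𝟙Below u = tripleSum-matches𝟙Below ℕ.≤-refl (ℕ.+-mono-≤ {1} {2} (s≤s z≤n) (ℕ.m≤n*m u 2))
  (ℕ.+-mono-≤ {1} {2} (s≤s z≤n) (ℕ.m≤n*m u 3))

+-matches𝟙Below : ∀ {v f g} → Matches𝟙Below v f → (∀ a n → n < v → g a n ≡ 0ℤ) → Matches𝟙Below v (f +ˢ g)
+-matches𝟙Below {f = f} {g} mf zg a n n<v = trans (+ˢ-at f g a n)
  (trans (cong₂ ℤ._+_ (mf a n n<v) (zg a n n<v)) (ℤ.+-identityʳ _))

xq^-·-low : ∀ v f a n → n < v → (xq^ v · f) a n ≡ 0ℤ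
xq^-·-low v f a n n<v = x^q^-·-zero 1 v f {a} (inj₂ n<v)

xq^^-·-low : ∀ v k f a n → n < v → (xq^ v ^ˢ suc k · f) a n ≡ 0ℤ
xq^^-·-low v k f a n n<v = trans (at (Ring.*-assoc (xq^ v) (xq^ v ^ˢ k) f) a n) (xq^-·-low v _ a n n<v)

GF-matches𝟙Below : ∀ t u → t ≢ dead → Matches𝟙Below (1 + u) (GF t u)
GF-matches𝟙Below free u _ = +-matches𝟙Below (φ-matches𝟙Below u) (xq^^-·-low (1 + u) 1 (φ (2 + u)))
GF-matches𝟙Below once u _ = φ-matches𝟙Below u
GF-matches𝟙Below single u _ = +-matches𝟙Below (GF-matches𝟙Below free u λ ())
  λ a n n<v → trans (at (Ring.*-assoc (xq^ (1 + u) ^ˢ 3) (q¹ ^ˢ 2) _) a n) (xq^^-·-low (1 + u) 2 (q¹ ^ˢ 2 · (-ˢ φ (3 + u))) a n n<v)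
GF-matches𝟙Below pair u _ = +-matches𝟙Below (φ-matches𝟙Below u)
  λ a n n<v → trans (at (Ring.*-assoc (xq^ (1 + u) ^ˢ 3) (q¹ ^ˢ 2) _) a n) (xq^^-·-low (1 + u) 2 (q¹ ^ˢ 2 · (-ˢ φ (3 + u))) a n n<v)
GF-matches𝟙Below double u _ a n n<v = φ-matches𝟙Below (1 + u) a n (ℕ.m<n⇒m<1+n n<v)
GF-matches𝟙Below dead u t≢dead = λ _ _ _ → ⊥-elim (t≢dead refl)

-- Enumeration

-- The list is kept along with its length because `HasSum` asks for the indices that contribute.
record Enumerates (P : List ℕ → Set) (c : ℤ) : Set where
  field
    list     : List (List ℕ)
    unique   : Unique list
    sound    : All P list
    complete : ∀ {π} → P π → π ∈ list
    count    : + length list ≡ c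
open Enumerates

OfSize : (List ℕ → Set) → ℕ → ℕ → List ℕ → Set
OfSize O m n π = O π × length π ≡ m × sum π ≡ n

-- Bounding the size makes the recursion on the smallest part end: a partition of size below v has
-- no part ≥ v.
EnumeratesBelow : ℕ → (List ℕ → Set) → Series → Set
EnumeratesBelow b O f = ∀ m n → n < b → Enumerates (OfSize O m n) (f m n)

enumerates-∅ : ∀ {P c} → (∀ π → ¬ P π) → c ≡ 0ℤ → Enumerates P c
enumerates-∅ ¬P c≡0 = record
  { list = [] ; unique = [] ; sound = [] ; complete = λ p → ⊥-elim (¬P _ p) ; count = sym c≡0 }

enumerates-∪ : ∀ {b O O′ f f′} → (∀ {π} → O π → ¬ O′ π) →
               EnumeratesBelow b O f → EnumeratesBelow b O′ f′ → EnumeratesBelow b (O ∪ O′) (f +ˢ f′)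
enumerates-∪ {f = f} {f′} disjoint e e′ m n n<b = record
  { list     = list l ++ list l′
  ; unique   = Unique.++⁺ (unique l) (unique l′)
      λ (p , p′) → disjoint (proj₁ (All.lookup (sound l) p)) (proj₁ (All.lookup (sound l′) p′))
  ; sound    = All.++⁺ (All.map (λ (o , s) → inj₁ o , s) (sound l)) (All.map (λ (o , s) → inj₂ o , s) (sound l′))
  ; complete = λ where
      (inj₁ o , s) → ∈-++⁺ˡ (complete l (o , s))
      (inj₂ o , s) → ∈-++⁺ʳ (list l) (complete l′ (o , s))
  ; count    = trans (cong +_ (length-++ (list l)))
      (trans (cong₂ ℤ._+_ (count l) (count l′)) (sym (+ˢ-at f f′ m n)))
  }
  where
  l  = e m n n<b
  l′ = e′ m n n<b

data _∷ᴾ_ (v : ℕ) (O : List ℕ → Set) : List ℕ → Set where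
  cons : ∀ {π} → O π → (v ∷ᴾ O) (v ∷ π)

enumerates-∷ : ∀ {b O f} v → EnumeratesBelow b O f → EnumeratesBelow b (v ∷ᴾ O) (xq^ v · f)
enumerates-∷ {f = f} v e zero n n<b = enumerates-∅ (λ { _ (cons _ , () , _) }) (x^q^-·-zero 1 v f {n = n} (inj₁ (s≤s z≤n)))
enumerates-∷ {b} {O} {f} v e (suc m) n n<b = go (position v n) n<b
  where
  go : ∀ {n} → Position v n → n < b → Enumerates (OfSize (v ∷ᴾ O) (suc m) n) ((xq^ v · f) (suc m) n)
  go (below n<v) _ = enumerates-∅
    (λ { (_ ∷ π) (cons _ , _ , refl) → ℕ.m+n≮m v (sum π) n<v }) (x^q^-·-zero 1 v f {suc m} (inj₂ n<v))
  go (above n) v+n<b = record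
    { list     = map (v ∷_) (list l)
    ; unique   = Unique.map⁺ ∷-injectiveʳ (unique l)
    ; sound    = All.map⁺ (All.map (λ (o , p , r) → cons o , cong suc p , cong (_+_ v) r) (sound l))
    ; complete = λ { (cons o , p , r) → ∈-map⁺ (v ∷_) (complete l (o , ℕ.suc-injective p , ℕ.+-cancelˡ-≡ v _ _ r)) }
    ; count    = trans (cong +_ (length-map (v ∷_) (list l))) (trans (count l) (sym (x^q^-shift 1 v f m n)))
    }
    where l = e m n (ℕ.≤-<-trans (ℕ.m≤n+m n v) v+n<b)

enumerates-cong : ∀ {b O O′ f f′} → (∀ {π} → O π → O′ π) → (∀ {π} → O′ π → O π) → f ≈ f′ →
                  EnumeratesBelow b O f → EnumeratesBelow b O′ f′
enumerates-cong to from f≈f′ e m n n<b = record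
  { list     = list l
  ; unique   = unique l
  ; sound    = All.map (λ (o , s) → to o , s) (sound l)
  ; complete = λ (o , s) → complete l (from o , s)
  ; count    = trans (count l) (at f≈f′ m n)
  }
  where l = e m n n<b

Ok-base : ∀ t u → t ≢ dead → EnumeratesBelow (1 + u) (Ok t (1 + u)) (GF t u)
Ok-base t u t≢dead zero zero n<v = record
  { list     = [] ∷ []
  ; unique   = [] ∷ []
  ; sound    = (Ok-[] t (1 + u) t≢dead , refl , refl) ∷ []
  ; complete = λ { {[]} _ → here refl ; {_ ∷ _} (_ , () , _) }
  ; count    = sym (GF-matches𝟙Below t u t≢dead 0 0 n<v)
  }
Ok-base t u t≢dead zero (suc n) n<v =
  enumerates-∅ (λ { [] (_ , _ , ()) ; (_ ∷ _) (_ , () , _) }) (GF-matches𝟙Below t u t≢dead 0 (suc n) n<v)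
Ok-base t u t≢dead (suc m) n n<v = enumerates-∅
  (λ { (x ∷ π) (o , _ , refl) → ℕ.<⇒≱ n<v (ℕ.≤-trans (Ok-head t o) (ℕ.m≤m+n x (sum π))) })
  (GF-matches𝟙Below t u t≢dead (suc m) n n<v)

dead? : ∀ t → t ≡ dead ⊎ t ≢ dead
dead? free   = inj₂ λ ()
dead? once   = inj₂ λ ()
dead? single = inj₂ λ ()
dead? pair   = inj₂ λ ()
dead? double = inj₂ λ ()
dead? dead   = inj₁ refl

-- Each step lowers d and raises v, so the bound d + v on the size stays fixed until v has reached
-- it. The state `dead` is treated first: its series is 0, not 1 modulo q^v, so it has no place in
-- the base case.
Ok-enumerates : ∀ d t u → EnumeratesBelow (d + (1 + u)) (Ok t (1 + u)) (GF t u)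
Ok-enumerates d t u with dead? t
Ok-enumerates d       t u | inj₁ refl = λ m n _ → enumerates-∅ (λ _ ()) (0ˢ-at m n)
Ok-enumerates zero    t u | inj₂ t≢dead = Ok-base t u t≢dead
Ok-enumerates (suc d) t u | inj₂ _ = subst (λ b → EnumeratesBelow b (Ok t v) (GF t u)) (ℕ.+-suc d v)
  (enumerates-cong to from (Ring.sym (GF-step t u))
    (enumerates-∪ disjoint₂
      (enumerates-∪ disjoint₁ (rec (next₀ t)) (enumerates-∷ v (rec (next₁ t))))
      (enumerates-∷ v (enumerates-∷ v (rec (next₂ t))))))
  where
  v = 1 + u
  O₀ = Ok (next₀ t) (1 + v)
  O₁ = Ok (next₁ t) (1 + v)
  O₂ = Ok (next₂ t) (1 + v)

  rec : ∀ t → EnumeratesBelow (d + (1 + v)) (Ok t (1 + v)) (GF t (1 + u))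
  rec t = Ok-enumerates d t (1 + u)

  to : ∀ {π} → ((O₀ ∪ (v ∷ᴾ O₁)) ∪ (v ∷ᴾ (v ∷ᴾ O₂))) π → Ok t v π
  to (inj₁ (inj₁ o))        = join t (none o)
  to (inj₁ (inj₂ (cons o))) = join t (one o)
  to (inj₂ (cons (cons o))) = join t (two o)

  from : ∀ {π} → Ok t v π → ((O₀ ∪ (v ∷ᴾ O₁)) ∪ (v ∷ᴾ (v ∷ᴾ O₂))) π
  from o with split t o
  ... | none o = inj₁ (inj₁ o)
  ... | one o  = inj₁ (inj₂ (cons o))
  ... | two o  = inj₂ (cons (cons o))

  head≢v : ∀ t {π} → ¬ Ok t (1 + v) (v ∷ π)
  head≢v t o = ℕ.1+n≰n (Ok-head t o)

  disjoint₁ : ∀ {π} → O₀ π → ¬ (v ∷ᴾ O₁) π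
  disjoint₁ o (cons _) = head≢v (next₀ t) o

  disjoint₂ : ∀ {π} → (O₀ ∪ (v ∷ᴾ O₁)) π → ¬ (v ∷ᴾ (v ∷ᴾ O₂)) π
  disjoint₂ (inj₁ o)        (cons (cons _)) = head≢v (next₀ t) o
  disjoint₂ (inj₂ (cons o)) (cons (cons _)) = head≢v (next₁ t) o

𝒫-enumerates : ∀ m n → Enumerates (OfSize 𝒫 m n) (GF single 0 m n)
-- Starting at v = 1 with d = n gives the bound n + 1, just enough for size n.
𝒫-enumerates m n = enumerates-cong Ok⇒𝒫 𝒫⇒Ok Ring.refl (Ok-enumerates n single 0) m n (ℕ.m<m+n n (s≤s z≤n))

x^q^-self : ∀ a n → (x^ a q^ n) a n ≡ 1ℤ
x^q^-self a n = cong₂ (λ s t → if s ∧ t then 1ℤ else 0ℤ) (≡ᵇ-refl a) (≡ᵇ-refl n)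
  where
  ≡ᵇ-refl : ∀ n → (n ℕ.≡ᵇ n) ≡ true
  ≡ᵇ-refl zero    = refl
  ≡ᵇ-refl (suc n) = ≡ᵇ-refl n

𝒫-hasSum : HasSum 𝒫 (λ π → x^ (length π) q^ (sum π)) (GF single 0)
𝒫-hasSum a n = list e , unique e , All.map proj₁ (sound e) , outside , trans (total (sound e)) (count e)
  where
  e = 𝒫-enumerates a n

  outside : ∀ π → 𝒫 π → π ∉ list e → (x^ (length π) q^ (sum π)) a n ≡ 0ℤ
  outside π p π∉ with a ℕ.≡ᵇ length π in eq | n ℕ.≡ᵇ sum π in eq′
  ... | true  | true  = ⊥-elim (π∉ (complete e (p ,
          sym (ℕ.≡ᵇ⇒≡ a (length π) (subst T (sym eq) _)) , sym (ℕ.≡ᵇ⇒≡ n (sum π) (subst T (sym eq′) _)))))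
  ... | true  | false = refl
  ... | false | _     = refl

  total : ∀ {L} → All (OfSize 𝒫 a n) L → sumℤ (map (λ π → (x^ (length π) q^ (sum π)) a n) L) ≡ + length L
  total [] = refl
  total ((_ , refl , refl) ∷ ps) = cong₂ ℤ._+_ (x^q^-self a n) (total ps)

-- The right-hand side

num : ℕ → ℕ → ℕ → Series
num i j k = let N = i + 2 * j + 3 * k in
    x^ N       q^ ((N * (N ∸ 1)) / 2 + i + j ^ 2 + 2 * j + 2 * k)
  ⊕ x^ (N + 2) q^ (((N + 2) * (N + 1)) / 2 + i + j ^ 2 + 2 * j + 2 * k + 1)
  ⊖ x^ (N + 3) q^ (((N + 3) * (N + 2)) / 2 + i + j ^ 2 + 2 * j + 2 * k + 2)

summand : ℕ → ℕ → ℕ → Series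
summand i j k = num i j k ⊘ denominator i j k

summand-XOrder : ∀ i j k → XOrder (weight i j k) (summand i j k)
summand-XOrder i j k {a} n a<N = ⊛-zero (num i j k) (1/denominator i j k) a n λ b m b≤a _ →
  trans (cong (ℤ._* 1/denominator i j k (a ∸ b) (n ∸ m)) (num-zero b m (ℕ.≤-<-trans b≤a a<N))) (ℤ.*-zeroˡ (1/denominator i j k (a ∸ b) (n ∸ m)))
  where
  num-zero : ∀ b m → b < weight i j k → num i j k b m ≡ 0ℤ
  num-zero b m b<N = cong₂ ℤ._-_ (cong₂ ℤ._+_
    (x^q^-zero _ _ {b} {m} (inj₁ b<N)) (x^q^-zero _ _ {b} {m} (inj₁ (ℕ.m≤n⇒m≤n+o 2 b<N))))
    (x^q^-zero _ _ {b} {m} (inj₁ (ℕ.m≤n⇒m≤n+o 3 b<N)))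

⊕≈+ˢ : ∀ f g → f ⊕ g ≈ f +ˢ g
⊕≈+ˢ f g = coeffwise λ a n → sym (+ˢ-at f g a n)

-- The triangular exponents at N + 2 and N + 3 exceed the one at N by 2N + 1 and 3N + 3. This moves
-- (1, 2, 2) to (3, 6, 8) and (4, 8, 11), the parameters of φ 2 and φ 3, and with the extra q and q²
-- leaves x²q² and x³q⁵.
summand-terms : ∀ i j k →
  term 1 2 2 i j k +ˢ (x^ 2 q^ 2) · term 3 6 8 i j k ≈ summand i j k +ˢ (x^ 3 q^ 5) · term 4 8 11 i j k
summand-terms i j k = Ring.sym (begin
  num i j k ⊛ e +ˢ (x^ 3 q^ 5) · term 4 8 11 i j k
    ≈⟨ Ring.+-cong (⊛≈· (num i j k) e) (absorb 3 5 (exponent 4 8 11 i j k)) ⟩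
  num i j k · e +ˢ (x^ (3 + N) q^ (5 + exponent 4 8 11 i j k)) · e
    ≈⟨ Ring.+-congˡ (Ring.*-congʳ (x^q^-cong (ℕ.+-comm 3 N) (exponent₃ i j k))) ⟩
  num i j k · e +ˢ m₃ · e           ≈⟨ Ring.distribʳ e (num i j k) m₃ ⟨
  (num i j k +ˢ m₃) · e             ≈⟨ Ring.*-congʳ (Ring.trans (⊖-+ˢ (m₁ ⊕ m₂) m₃) (⊕≈+ˢ m₁ m₂)) ⟩
  (m₁ +ˢ m₂) · e                    ≈⟨ Ring.distribʳ e m₁ m₂ ⟩
  m₁ · e +ˢ m₂ · e
    ≈⟨ Ring.+-cong (Ring.*-congʳ (x^q^-cong {N} refl (exponent₁ i j k)))
                   (Ring.*-congʳ (x^q^-cong (ℕ.+-comm N 2) (exponent₂ i j k))) ⟩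
  term 1 2 2 i j k +ˢ (x^ (2 + N) q^ (2 + exponent 3 6 8 i j k)) · e
    ≈⟨ Ring.+-congˡ (absorb 2 2 (exponent 3 6 8 i j k)) ⟨
  term 1 2 2 i j k +ˢ (x^ 2 q^ 2) · term 3 6 8 i j k ∎)
  where
  open ≈-Reasoning
  N : ℕ
  N = weight i j k

  e m₁ m₂ m₃ : Series
  e  = 1/denominator i j k
  m₁ = x^ N       q^ ((N * (N ∸ 1)) / 2 + i + j ^ 2 + 2 * j + 2 * k)
  m₂ = x^ (N + 2) q^ (((N + 2) * (N + 1)) / 2 + i + j ^ 2 + 2 * j + 2 * k + 1)
  m₃ = x^ (N + 3) q^ (((N + 3) * (N + 2)) / 2 + i + j ^ 2 + 2 * j + 2 * k + 2)

  absorb : ∀ α β B → (x^ α q^ β) · ((x^ N q^ B) · e) ≈ (x^ (α + N) q^ (β + B)) · e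
  absorb α β B = Ring.trans (Ring.sym (Ring.*-assoc _ _ e)) (Ring.*-congʳ (x^q^-· α β N B))

  exponent₁ : ∀ i j k → let N = weight i j k in
    (N * (N ∸ 1)) / 2 + i + j ^ 2 + 2 * j + 2 * k ≡ exponent 1 2 2 i j k
  exponent₁ i j k rewrite tri-closed (weight i j k) = lemma i j k (tri (weight i j k))
    where
    lemma : ∀ i j k t → t + i + j * (j * 1) + 2 * j + 2 * k ≡ t + (1 * i + (2 * j + j * j) + 2 * k)
    lemma = solve-∀

  exponent₂ : ∀ i j k → let N = weight i j k in
    ((N + 2) * (N + 1)) / 2 + i + j ^ 2 + 2 * j + 2 * k + 1 ≡ 2 + exponent 3 6 8 i j k
  exponent₂ i j k rewrite ℕ.+-comm (weight i j k) 2 | ℕ.+-comm (weight i j k) 1 | tri-closed (2 + weight i j k) =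
    lemma i j k (tri (weight i j k))
    where
    lemma : ∀ i j k t →
      1 + (i + 2 * j + 3 * k) + (i + 2 * j + 3 * k + t) + i + j * (j * 1) + 2 * j + 2 * k + 1
      ≡ 2 + (t + (3 * i + (6 * j + j * j) + 8 * k))
    lemma = solve-∀

  exponent₃ : ∀ i j k → let N = weight i j k in
    5 + exponent 4 8 11 i j k ≡ ((N + 3) * (N + 2)) / 2 + i + j ^ 2 + 2 * j + 2 * k + 2
  exponent₃ i j k rewrite ℕ.+-comm (weight i j k) 3 | ℕ.+-comm (weight i j k) 2 | tri-closed (3 + weight i j k) =
    lemma i j k (tri (weight i j k))
    where
    lemma : ∀ i j k t →
      5 + (t + (4 * i + (8 * j + j * j) + 11 * k)) ≡
      2 + (i + 2 * j + 3 * k) + (1 + (i + 2 * j + 3 * k) + (i + 2 * j + 3 * k + t)) + i + j * (j * 1) + 2 * j + 2 * k + 2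
    lemma = solve-∀

∑³ : (ℕ → ℕ → ℕ → Series) → Series
∑³ f = ∑ λ i → ∑ λ j → ∑ (f i j)

∑³-linear : ∀ {f g u} a b c → (∀ i j k → f i j k ≈ g i j k +ˢ u · term a b c i j k) →
            ∑³ f ≈ ∑³ g +ˢ u · tripleSum a b c
∑³-linear {f} {g} a b c p =
  ∑-linear {λ i → ∑ λ j → ∑ (f i j)} {λ i → ∑ λ j → ∑ (g i j)} {∑jk-term a b c}
    (λ i → ∑-linear {λ j → ∑ (f i j)} {λ j → ∑ (g i j)} {∑k-term a b c i}
      (λ j → ∑-linear {f i j} {g i j} {term a b c i j} (p i j) (term-XOrder-k a b c i j))
      (∑k-XOrder-j a b c i))
    (∑jk-XOrder-i a b c)

∑³-summand : ∑³ summand ≈ GF single 0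
∑³-summand = begin
  S                                            ≈⟨ Ring.+-identityʳ S ⟨
  S +ˢ 0ˢ                                      ≈⟨ Ring.+-congˡ (Ring.trans (Ring.*-congˡ (Ring.-‿inverseʳ (φ 3))) (Ring.zeroʳ w₃)) ⟨
  S +ˢ w₃ · (φ 3 +ˢ -ˢ φ 3)                     ≈⟨ Ring.+-congˡ (Ring.distribˡ w₃ (φ 3) (-ˢ φ 3)) ⟩
  S +ˢ (w₃ · φ 3 +ˢ w₃ · (-ˢ φ 3))             ≈⟨ Ring.+-assoc S _ _ ⟨
  S +ˢ w₃ · φ 3 +ˢ w₃ · (-ˢ φ 3)               ≈⟨ Ring.+-congʳ (∑³-linear {G} {summand} {w₃} 4 8 11 summand-terms) ⟨
  ∑³ G +ˢ w₃ · (-ˢ φ 3)                        ≈⟨ Ring.+-congʳ (∑³-linear {G} {term 1 2 2} {w₂} 3 6 8 (λ i j k → Ring.refl)) ⟩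
  φ 0 +ˢ w₂ · φ 2 +ˢ w₃ · (-ˢ φ 3)
    ≈⟨ Ring.+-cong (Ring.+-congˡ (Ring.*-congʳ (Ring.sym (x^q^-^ 1 1 2)))) (Ring.*-congʳ (x^q^-split 3 2 1 5 refl)) ⟩
  GF single 0                                   ∎
  where
  open ≈-Reasoning
  S w₂ w₃ : Series
  S  = ∑³ summand
  w₂ = x^ 2 q^ 2
  w₃ = x^ 3 q^ 5
  G : ℕ → ℕ → ℕ → Series
  G i j k = term 1 2 2 i j k +ˢ w₂ · term 3 6 8 i j k

-- Summation over a box of index triples

sumℤ-++ : ∀ xs ys → sumℤ (xs ++ ys) ≡ sumℤ xs ℤ.+ sumℤ ys
sumℤ-++ []       ys = sym (ℤ.+-identityˡ _)
sumℤ-++ (x ∷ xs) ys = trans (cong (ℤ._+_ x) (sumℤ-++ xs ys)) (sym (ℤ.+-assoc x _ _))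

sumℤ-cartesianProduct : ∀ {A B : Set} (f : A × B → ℤ) (xs : List A) (ys : List B) →
  sumℤ (map f (cartesianProduct xs ys)) ≡ sumℤ (map (λ x → sumℤ (map (λ y → f (x , y)) ys)) xs)
sumℤ-cartesianProduct f []       ys = refl
sumℤ-cartesianProduct f (x ∷ xs) ys = begin
  sumℤ (map f (map (x ,_) ys ++ cartesianProduct xs ys))
    ≡⟨ cong sumℤ (map-++ f (map (x ,_) ys) _) ⟩
  sumℤ (map f (map (x ,_) ys) ++ map f (cartesianProduct xs ys))
    ≡⟨ sumℤ-++ (map f (map (x ,_) ys)) _ ⟩
  sumℤ (map f (map (x ,_) ys)) ℤ.+ sumℤ (map f (cartesianProduct xs ys))
    ≡⟨ cong₂ ℤ._+_ (cong sumℤ (sym (map-∘ ys))) (sumℤ-cartesianProduct f xs ys) ⟩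
  sumℤ (map (λ x → sumℤ (map (λ y → f (x , y)) ys)) (x ∷ xs)) ∎
  where open ≡-Reasoning

sumℤ-upTo : ∀ (f : ℕ → ℤ) n → sumℤ (map f (upTo n)) ≡ sumℤ (applyUpTo f n)
sumℤ-upTo f n = cong sumℤ (map-applyUpTo id f n)

sumℤ-box : ∀ (f : ℕ → ℕ → ℕ → ℤ) n → let I = upTo n in
  sumℤ (map (λ (i , j , k) → f i j k) (cartesianProduct I (cartesianProduct I I)))
  ≡ sumℤ (applyUpTo (λ i → sumℤ (applyUpTo (λ j → sumℤ (applyUpTo (f i j) n)) n)) n)
sumℤ-box f n = begin
  sumℤ (map (λ (i , j , k) → f i j k) (cartesianProduct I (cartesianProduct I I)))
    ≡⟨ sumℤ-cartesianProduct (λ (i , j , k) → f i j k) I (cartesianProduct I I) ⟩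
  sumℤ (map (λ i → sumℤ (map (λ (j , k) → f i j k) (cartesianProduct I I))) I)
    ≡⟨ sumℤ-upTo (λ i → sumℤ (map (λ (j , k) → f i j k) (cartesianProduct I I))) n ⟩
  sumℤ (applyUpTo (λ i → sumℤ (map (λ (j , k) → f i j k) (cartesianProduct I I))) n)
    ≡⟨ sum-cong n (λ i _ → trans (sumℤ-cartesianProduct (λ (j , k) → f i j k) I I)
         (trans (sumℤ-upTo (λ j → sumℤ (map (f i j) I)) n) (sum-cong n λ j _ → sumℤ-upTo (f i j) n))) ⟩
  sumℤ (applyUpTo (λ i → sumℤ (applyUpTo (λ j → sumℤ (applyUpTo (f i j) n)) n)) n) ∎
  where
  open ≡-Reasoning
  I = upTo n

-- Each index is at most N and x^N divides the summand, so indices up to a suffice at x^a. The full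
-- cube is used because it is exactly the range of the nested truncations in `∑³`.
summand-hasSum : HasSum {ℕ × ℕ × ℕ} U (λ (i , j , k) → summand i j k) (GF single 0)
summand-hasSum a n = box , Unique.cartesianProduct⁺ up (Unique.cartesianProduct⁺ up up) , All.tabulate _ , outside , total
  where
  up : Unique (upTo (suc a))
  up = Unique.upTo⁺ (suc a)

  box : List (ℕ × ℕ × ℕ)
  box = cartesianProduct (upTo (suc a)) (cartesianProduct (upTo (suc a)) (upTo (suc a)))

  outside : ∀ (t : ℕ × ℕ × ℕ) → U t → t ∉ box → summand (proj₁ t) (proj₁ (proj₂ t)) (proj₂ (proj₂ t)) a n ≡ 0ℤ
  outside (i , j , k) _ t∉ =
    [ summand-XOrder i j k n , (λ N≤a → ⊥-elim (t∉ (inside N≤a))) ]′ (ℕ.<-≤-connex a (weight i j k))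
    where
    inside : weight i j k ≤ a → (i , j , k) ∈ box
    inside N≤a = ∈-cartesianProduct⁺ (bounded (i≤weight i j k))
      (∈-cartesianProduct⁺ (bounded (j≤weight i j k)) (bounded (k≤weight i j k)))
      where
      bounded : ∀ {l} → l ≤ weight i j k → l ∈ upTo (suc a)
      bounded l≤N = ∈-upTo⁺ (s≤s (ℕ.≤-trans l≤N N≤a))

  total : sumℤ (map (λ (i , j , k) → summand i j k a n) box) ≡ GF single 0 a n
  total = trans (sumℤ-box (λ i j k → summand i j k a n) (suc a)) (at ∑³-summand a n)

mainTheorem8 : ∃[ F ]
    HasSum 𝒫 (λ π → x^ (length π) q^ (sum π)) F
    × HasSum {ℕ × ℕ × ℕ} U
    (λ (i , j , k) →
    let N = i + 2 * j + 3 * k in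
    (   x^ N       q^ ((N * (N ∸ 1)) / 2 + i + j ^ 2 + 2 * j + 2 * k)
    ⊕ x^ (N + 2) q^ (((N + 2) * (N + 1)) / 2 + i + j ^ 2 + 2 * j + 2 * k + 1)
    ⊖ x^ (N + 3) q^ (((N + 3) * (N + 2)) / 2 + i + j ^ 2 + 2 * j + 2 * k + 2))
    ⊘ (qpoch 1 i ⊛ qpoch 2 j ⊛ qpoch 3 k))
    F
mainTheorem8 = GF single 0 , 𝒫-hasSum , summand-hasSum
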